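{- Let $G$ be a finite simple connected graph on $n$ vertices, and $L$ a positive integer such that the system $s\cdot\chi_C=1$ for every even cycle $C$ of $G$ of length $\le L$ is consistent over $\mathbb F_2$; let $W$ be the span of the vectors $\chi_C$ of these constraint cycles, $\mathcal F$ the family of switching classes of signings solving the system, and $\pi\colon W\to\mathbb F_2$ the linear form with $\pi(\chi_C)=1$ for every constraint cycle $C$. Then for every $k\ge1$, $$\min_{\sigma\in\mathcal F}\rho(A_\sigma)\le R_{\mathcal F}(k):=\Bigl(\sum_{z\in W}(-1)^{\pi(z)}N_{2k}(z)\Bigr)^{1/2k}.$$ By contrast, if $G$ is $d$-regular, the uniform average over all signings $\sigma\in\{\pm1\}^E$ satisfies $$\mathbb E_\sigma\operatorname{tr}(A_\sigma^{2k})=N_{2k}(0)\ge n\,t_{2k}(d),$$ where $t_{2k}(d)$ is the number of closed walks of length $2k$ at the root of the infinite $d$-regular tree. Hence $\bigl(\mathbb E_\sigma\operatorname{tr}(A_\sigma^{2k})\bigr)^{1/2k}$ is never below $(n\,t_{2k}(d))^{1/2k}$, whereas $R_{\mathcal F}(k)<(n\,t_{2k}(d))^{1/2k}$ holds if and only if $$\sum_{z\in W\setminus\{0\}}(-1)^{\pi(z)}N_{2k}(z)<-\bigl(N_{2k}(0)-n\,t_{2k}(d)\bigr).$$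
   Context: $G=(V,E)$. A signing is $\sigma\in\{\pm1\}^E$, encoded by $s\in\mathbb F_2^E$ with $\sigma_e=(-1)^{s_e}$; $A_\sigma$ is the signed adjacency matrix with $uv$ entry $\sigma_{uv}$ if $uv\in E$ and $0$ otherwise; $\rho(A_\sigma)=\max_i|\lambda_i(A_\sigma)|$. Switching at a vertex negates all edges at it and preserves the spectrum, so $\rho(A_\sigma)$ depends only on the switching class. For a cycle $C$, $\chi_C\in\mathbb F_2^E$ is the indicator vector of its edge set; even cycles are cycles of even length. When the system is consistent, $\pi(\sum_{C\in S}\chi_C)=|S|\bmod2$ is well defined on $W$. For a closed walk $w$ (with marked starting vertex and direction), its parity vector $z(w)\in\mathbb F_2^E$ has $z(w)_e$ equal to the number of traversals of $e$ modulo $2$. $N_\ell(z)$ is the number of closed walks of length $\ell$ in $G$ with parity vector $z$. -}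

module Defs where

open import Algebra.Bundles using (CommutativeRing; Semiring)
import Algebra.Definitions.RawSemiring as RawSemiringDefs
open import Data.Bool.Base using (if_then_else_)
open import Data.Fin.Base as Fin using (Fin)
import Data.Fin.Properties as Fin
open import Data.List.Base as List using (List; []; _∷_; _++_; allFin; concatMap; deduplicate; filter; foldr; length; upTo; cartesianProductWith)
import Data.List.Properties as List
open import Data.List.Membership.Propositional using (_∈_)
open import Data.List.Relation.Unary.All using (All)
import Data.List.Relation.Unary.Unique.DecPropositional as Unique
open import Data.Nat.Base as ℕ using (ℕ; zero; suc; parity)
import Data.Nat.Properties as ℕ
open import Data.Nat.Divisibility using (_∣?_)
open import Data.Parity.Base as ℙ using (Parity; 0ℙ; 1ℙ)
import Data.Parity.Properties as ℙ
open import Data.Product.Base using (Σ-syntax; ∃; ∃-syntax; _×_; _,_; proj₁; proj₂)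
import Data.Product.Properties as Product
open import Data.Sum.Base using (_⊎_)
open import Data.Vec.Base as Vec using (Vec; []; _∷_)
import Data.Vec.Properties as Vec
open import Data.Vec.Relation.Unary.Any using (any?)
open import Function.Definitions using (Injective)
open import Level using (0ℓ)
open import Relation.Binary.Construct.Closure.ReflexiveTransitive using (Star)
import Relation.Binary.Construct.StrictToNonStrict as StrictToNonStrict
open import Relation.Binary.Core using (Rel)
open import Relation.Binary.Definitions using (DecidableEquality)
open import Relation.Binary.PropositionalEquality.Core using (_≡_)
open import Relation.Binary.Structures using (IsStrictTotalOrder)
open import Relation.Nullary using (¬_; Dec; yes; no; does)
open import Relation.Nullary.Decidable using (¬?; _×-dec_; _⊎-dec_)
open import Relation.Unary using (Pred)

-- The (classical) real numbers, characterised up to isomorphism as a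
-- Dedekind-complete ordered field.  The value of 0# ⁻¹ is unspecified.
record RealNumbers : Set₁ where
  field
    commutativeRing : CommutativeRing 0ℓ 0ℓ

  open CommutativeRing commutativeRing public

  infix 4 _<_
  infix 9 _⁻¹
  field
    _<_                : Rel Carrier 0ℓ
    isStrictTotalOrder : IsStrictTotalOrder _≈_ _<_
    _⁻¹                : Carrier → Carrier

  open StrictToNonStrict _≈_ _<_ public using (_≤_)

  IsUpperBound : Pred Carrier 0ℓ → Carrier → Set
  IsUpperBound P b = ∀ x → P x → x ≤ b

  field
    0≉1           : ¬ 0# ≈ 1#
    ⁻¹-inverse    : ∀ x → ¬ x ≈ 0# → x * x ⁻¹ ≈ 1#
    +-monoˡ-<     : ∀ {x y} z → x < y → x + z < y + z
    *-pos         : ∀ {x y} → 0# < x → 0# < y → 0# < x * y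
    supremum      : (P : Pred Carrier 0ℓ) → ∃ P → ∃ (IsUpperBound P) →
                    ∃[ s ] IsUpperBound P s × (∀ b → IsUpperBound P b → s ≤ b)

  open IsStrictTotalOrder isStrictTotalOrder public using (compare; _<?_)
  open RawSemiringDefs (Semiring.rawSemiring semiring) public using (_^_; sum) renaming (_×_ to _·_)

  fromℕ : ℕ → Carrier
  fromℕ n = n · 1#

  ∣_∣ : Carrier → Carrier
  ∣ x ∣ = if does (x <? 0#) then - x else x

  IsMaximum IsMinimum : Pred Carrier 0ℓ → Carrier → Set
  IsMaximum P m = P m × (∀ x → P x → x ≤ m)
  IsMinimum P m = P m × (∀ x → P x → m ≤ x)

  -- r = x^{1/n}
  IsRoot : ℕ → Carrier → Carrier → Set
  IsRoot n x r = 0# ≤ r × r ^ n ≈ x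

  sumOver : {A : Set} → List A → (A → Carrier) → Carrier
  sumOver xs f = foldr (λ x acc → f x + acc) 0# xs

  syntax sumOver xs (λ x → e) = ∑[ x ∈ xs ] e

  average : {A : Set} → List A → (A → Carrier) → Carrier
  average xs f = sumOver xs f * fromℕ (length xs) ⁻¹

  Matrix : ℕ → Set
  Matrix n = Fin n → Fin n → Carrier

  identity : ∀ {n} → Matrix n
  identity i j = if does (i Fin.≟ j) then 1# else 0#

  _⊗_ : ∀ {n} → Matrix n → Matrix n → Matrix n
  (A ⊗ B) i j = sum (λ l → A i l * B l j)

  power : ∀ {n} → Matrix n → ℕ → Matrix n
  power A zero    = identity
  power A (suc k) = A ⊗ power A k

  trace : ∀ {n} → Matrix n → Carrier
  trace A = sum (λ i → A i i)

  IsEigenvalue : ∀ {n} → Matrix n → Carrier → Set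
  IsEigenvalue {n} A μ = Σ[ v ∈ (Fin n → Carrier) ] (∃[ i ] ¬ v i ≈ 0#) × (∀ i → sum (λ j → A i j * v j) ≈ μ * v i)

  -- Only real eigenvalues are considered, so this is the spectral radius
  -- for matrices with real spectrum, in particular symmetric ones.
  IsSpectralRadius : ∀ {n} → Matrix n → Carrier → Set
  IsSpectralRadius A = IsMaximum (λ x → ∃[ μ ] IsEigenvalue A μ × x ≈ ∣ μ ∣)

module Walks {V : Set} (_≟_ : DecidableEquality V) (neighbours : V → List V) where

  -- A walk of length ℓ is recorded by the ℓ + 1 vertices it visits.
  walksFrom : (ℓ : ℕ) → V → List (Vec V (suc ℓ))
  walksFrom zero    v = (v ∷ []) ∷ []
  walksFrom (suc ℓ) v = concatMap (λ u → List.map (v ∷_) (walksFrom ℓ u)) (neighbours v)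

  closedWalksAt : (ℓ : ℕ) → V → List (Vec V (suc ℓ))
  closedWalksAt ℓ v = filter (λ w → Vec.last w ≟ v) (walksFrom ℓ v)

steps : {V : Set} {ℓ : ℕ} → Vec V (suc ℓ) → Vec (V × V) ℓ
steps (v ∷ [])    = []
steps (u ∷ v ∷ w) = (u , v) ∷ steps (v ∷ w)

vectors : {A : Set} → List A → (m : ℕ) → List (Vec A m)
vectors xs zero    = [] ∷ []
vectors xs (suc m) = cartesianProductWith _∷_ xs (vectors xs m)

-- A vertex of the infinite d-regular tree is the word of labels on the path
-- to the root [], latest label first; consecutive labels differ.  (Lists with
-- equal consecutive labels are not reachable from the root.)
treeNeighbours : (d : ℕ) → List (Fin d) → List (List (Fin d))
treeNeighbours d []      = List.map (_∷ []) (allFin d)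
treeNeighbours d (a ∷ w) = w ∷ List.map (λ b → b ∷ a ∷ w) (filter (λ b → ¬? (b Fin.≟ a)) (allFin d))

treeClosedWalks : (ℓ d : ℕ) → ℕ
treeClosedWalks ℓ d = length (closedWalksAt ℓ [])
  where open Walks (List.≡-dec Fin._≟_) (treeNeighbours d)

-- 𝔽₂ is represented by Parity.
𝔽₂^ : ℕ → Set
𝔽₂^ m = Vec Parity m

module _ {m : ℕ} where

  infixl 6 _⊕_
  infix 4 _≟ᵛ_

  𝟘 : 𝔽₂^ m
  𝟘 = Vec.replicate m 0ℙ

  _⊕_ : 𝔽₂^ m → 𝔽₂^ m → 𝔽₂^ m
  _⊕_ = Vec.zipWith ℙ._+_

  dot : 𝔽₂^ m → 𝔽₂^ m → Parity
  dot s z = Vec.foldr _ ℙ._+_ 0ℙ (Vec.zipWith ℙ._*_ s z)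

  _≟ᵛ_ : DecidableEquality (𝔽₂^ m)
  _≟ᵛ_ = Vec.≡-dec ℙ._≟_

  subsetSums : List (𝔽₂^ m) → List (𝔽₂^ m)
  subsetSums []       = 𝟘 ∷ []
  subsetSums (g ∷ gs) = subsetSums gs ++ List.map (g ⊕_) (subsetSums gs)

  -- All elements of the linear span, each listed exactly once.
  span : List (𝔽₂^ m) → List (𝔽₂^ m)
  span gs = deduplicate _≟ᵛ_ (subsetSums gs)

-- The edge {u , v} is recorded by the pair with u < v.
record SimpleGraph : Set where
  field
    order    : ℕ
    size     : ℕ
    ends     : Fin size → Fin order × Fin order
    ordered  : ∀ e → proj₁ (ends e) Fin.< proj₂ (ends e)
    distinct : Injective _≡_ _≡_ ends

module _ (G : SimpleGraph) where
  open SimpleGraph G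

  Joins : Fin size → Fin order × Fin order → Set
  Joins e (u , v) = ends e ≡ (u , v) ⊎ ends e ≡ (v , u)

  joins? : ∀ e uv → Dec (Joins e uv)
  joins? e (u , v) = (ends e ≟ (u , v)) ⊎-dec (ends e ≟ (v , u))
    where _≟_ = Product.≡-dec Fin._≟_ Fin._≟_

  Adjacent : Rel (Fin order) 0ℓ
  Adjacent u v = ∃[ e ] Joins e (u , v)

  adjacent? : ∀ u v → Dec (Adjacent u v)
  adjacent? u v = Fin.any? (λ e → joins? e (u , v))

  neighbours : Fin order → List (Fin order)
  neighbours v = filter (adjacent? v) (allFin order)

  Connected : Set
  Connected = Fin order × (∀ u v → Star Adjacent u v)

  Regular : ℕ → Set
  Regular d = ∀ v → length (neighbours v) ≡ d

  closedWalks : (ℓ : ℕ) → List (Vec (Fin order) (suc ℓ))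
  closedWalks ℓ = concatMap (closedWalksAt ℓ) (allFin order)
    where open Walks Fin._≟_ neighbours

  parityVector : ∀ {ℓ} → Vec (Fin order) (suc ℓ) → 𝔽₂^ size
  parityVector w = Vec.tabulate (λ e → parity (Vec.count (joins? e) (steps w)))

  -- N_ℓ(z)
  closedWalkCount : ℕ → 𝔽₂^ size → ℕ
  closedWalkCount ℓ z = length (filter (λ w → parityVector w ≟ᵛ z) (closedWalks ℓ))

  -- For ℓ ≥ 3: the closed walks repeating no vertex except their endpoint.
  -- Each cycle is listed once for every start and direction.
  cycles : (ℓ : ℕ) → List (Vec (Fin order) (suc ℓ))
  cycles ℓ = filter (λ w → unique? (Vec.toList (Vec.tail w))) (closedWalks ℓ)
    where open Unique Fin._≟_ using (unique?)

  χ : ∀ {ℓ} → Vec (Fin order) (suc ℓ) → 𝔽₂^ size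
  χ w = Vec.tabulate (λ e → if does (any? (joins? e) (steps w)) then 1ℙ else 0ℙ)

  -- The vectors χ_C for the even cycles C of length at most L.
  constraints : ℕ → List (𝔽₂^ size)
  constraints L = concatMap (λ ℓ → List.map χ (cycles ℓ)) evenLengths
    where evenLengths = filter (λ ℓ → (3 ℕ.≤? ℓ) ×-dec (2 ∣? ℓ)) (upTo (suc L))

  Solves : ℕ → 𝔽₂^ size → Set
  Solves L s = All (λ c → dot s c ≡ 1ℙ) (constraints L)

  Consistent : ℕ → Set
  Consistent L = ∃ (Solves L)

  W : ℕ → List (𝔽₂^ size)
  W L = span (constraints L)

  record IsConstraintForm (L : ℕ) (π : 𝔽₂^ size → Parity) : Set where
    field
      additive    : ∀ {z z′} → z ∈ W L → z′ ∈ W L → π (z ⊕ z′) ≡ π z ℙ.+ π z′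
      constraint  : All (λ c → π c ≡ 1ℙ) (constraints L)

  signings : List (𝔽₂^ size)
  signings = vectors (0ℙ ∷ 1ℙ ∷ []) size

  incidence : Fin order → 𝔽₂^ size
  incidence v = Vec.tabulate λ e →
    if does ((proj₁ (ends e) Fin.≟ v) ⊎-dec (proj₂ (ends e) Fin.≟ v)) then 1ℙ else 0ℙ

  SwitchedAtVertex : Rel (𝔽₂^ size) 0ℓ
  SwitchedAtVertex s t = ∃[ v ] t ≡ s ⊕ incidence v

  SwitchingEquivalent : Rel (𝔽₂^ size) 0ℓ
  SwitchingEquivalent = Star SwitchedAtVertex

  -- The switching class of s belongs to the family 𝓕.
  ClassInFamily : ℕ → 𝔽₂^ size → Set
  ClassInFamily L s = ∃[ t ] Solves L t × SwitchingEquivalent t s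

module SignedGraphs (ℝ : RealNumbers) (G : SimpleGraph) where
  open RealNumbers ℝ
  open SimpleGraph G

  sign : Parity → Carrier
  sign 0ℙ = 1#
  sign 1ℙ = - 1#

  signedAdjacency : 𝔽₂^ size → Matrix order
  signedAdjacency s u v with adjacent? G u v
  ... | yes (e , _) = sign (Vec.lookup s e)
  ... | no _        = 0#

  -- x = min_{σ ∈ 𝓕} ρ(A_σ)
  IsMinSpectralRadius : ℕ → Carrier → Set
  IsMinSpectralRadius L =
    IsMinimum (λ x → ∃[ s ] ClassInFamily G L s × IsSpectralRadius (signedAdjacency s) x)

  expectedTrace : ℕ → Carrier
  expectedTrace ℓ = average (signings G) (λ s → trace (power (signedAdjacency s) ℓ))

  signedCount : (𝔽₂^ size → Parity) → ℕ → List (𝔽₂^ size) → Carrier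
  signedCount π ℓ zs = ∑[ z ∈ zs ] (sign (π z) * fromℕ (closedWalkCount G ℓ z))

-- The trace of A_σ^ℓ is the sum over closed walks w of (-1)^{s·z(w)}.  Summed
-- over the affine space of solutions s of the constraint system, a character
-- (-1)^{s·z} gives (-1)^{π(z)} times the number of solutions if z ∈ W, and 0
-- otherwise, since then some t orthogonal to W has t·z = 1 and shifting by t
-- flips the sign.  Hence the signed count is the mean of tr A_σ^{2k} over the
-- family, and tr A_σ^{2k} ≥ ρ(A_σ)^{2k}.  With no constraints at all the same
-- computation gives the mean N_{2k}(0) over all signings.
--
-- Spectral radii exist without the spectral theorem: the supremum t of
-- |Av|²/|v|² makes t - A² neither coercive nor negative somewhere, and a
-- symmetric matrix which is neither is singular (induct on the size, taking
-- Schur complements), so √t or -√t is an eigenvalue of A.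
--
-- The tree bound is obtained by counting alone: the number of tree walks back
-- to the root depends only on the distance h from it, and is at most the number
-- of graph walks back to v whose parity vector equals that of any given path
-- of length h from v.

module Submission where

open import Defs
open import Algebra.Bundles using (RawRing)
import Algebra.Properties.AbelianGroup as AbelianGroupProperties
import Algebra.Properties.CommutativeMonoid.Sum as CommutativeMonoidSum
import Algebra.Properties.CommutativeSemigroup as CommutativeSemigroupProperties
import Algebra.Properties.Ring as RingProperties
import Algebra.Properties.Semiring.Exp as Exp
import Algebra.Properties.Semiring.Mult as Mult
import Algebra.Properties.Semiring.Sum as SemiringSum
import Algebra.Solver.Ring as RingSolver
open import Algebra.Solver.Ring.AlmostCommutativeRing using (_-Raw-AlmostCommutative⟶_; fromCommutativeRing)
open import Data.Bool.Base using (_∨_; false; if_then_else_; true)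
open import Data.Fin.Base as Fin using (Fin; suc; zero)
import Data.Fin.Properties as Fin
open import Data.List.Base as List using (List; []; _++_; _∷_; allFin; concatMap; filter; length; map)
import Data.List.Membership.DecPropositional as DecMembership
open import Data.List.Membership.Propositional using (_∈_; _∉_)
open import Data.List.Membership.Propositional.Properties using (∈-++⁺ʳ; ∈-++⁺ˡ; ∈-++⁻; ∈-allFin; ∈-cartesianProductWith⁺; ∈-deduplicate⁺; ∈-deduplicate⁻; ∈-filter⁺; ∈-filter⁻; ∈-map⁺; ∈-map⁻)
import Data.List.Properties as List
open import Data.List.Relation.Unary.All as All using (All; []; _∷_)
import Data.List.Relation.Unary.All.Properties as All
open import Data.List.Relation.Unary.Any using (here; there)
open import Data.List.Relation.Unary.Unique.DecPropositional.Properties using (deduplicate-!)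
open import Data.List.Relation.Unary.Unique.Propositional using (Unique; _∷_)
open import Data.List.Relation.Unary.Unique.Propositional.Properties using (allFin⁺)
open import Data.Maybe.Base using (Maybe; just; nothing)
open import Data.Nat.Base as ℕ using (parity; suc; s≤s; zero; z≤n; ℕ)
import Data.Nat.ListAction as ListAction
import Data.Nat.Properties as ℕ
open import Data.Parity.Base as ℙ using (0ℙ; 1ℙ; Parity)
import Data.Parity.Properties as ℙ
open import Data.Product.Base using (_,_; _×_; proj₁; proj₂; ∃; ∃-syntax)
open import Data.Sum.Base using (_⊎_; inj₁; inj₂; swap)
open import Data.Vec.Base as Vec using (Vec; []; _∷_)
open import Data.Vec.Functional using (Vector)
import Data.Vec.Properties as Vec
open import Function.Base using (_∘_; id)
open import Function.Bundles using (_⇔_; mk⇔)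
open import Function.Construct.Composition using (_⇔-∘_)
open import Level using (0ℓ)
open import Relation.Binary.Construct.Closure.ReflexiveTransitive as Star using (Star; _◅_)
import Relation.Binary.Construct.StrictToNonStrict as StrictToNonStrict
open import Relation.Binary.Definitions using (DecidableEquality; tri<; tri>; tri≈)
open import Relation.Binary.PropositionalEquality.Core as ≡ using (_≡_; _≢_)
open import Relation.Binary.PropositionalEquality.Properties using (module ≡-Reasoning)
import Relation.Binary.Reasoning.Setoid as SetoidReasoning
open import Relation.Binary.Structures using (IsStrictTotalOrder)
open import Relation.Nullary using (Dec; does; no; yes; ¬_)
open import Relation.Nullary.Decidable using (dec-false; dec-true; decidable-stable; does-⇔; ¬?)
open import Relation.Nullary.Negation using (contradiction)
open import Relation.Unary using (Decidable; Pred)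

-- Neither compactness nor excluded middle for statements about all vectors is invoked, so the
-- trichotomy for symmetric matrices is an algorithm: pivot elimination that ends with explicit
-- data, namely constants of coercivity, a vector where the form is negative, or a kernel vector.
-- Elimination multiplies by the pivot and never divides by it, which turns every verification into
-- a polynomial identity plus visibly nonnegative terms. What is usually read off from a
-- diagonalisation comes from Cauchy-Schwarz instead: tr A^{2k} is the squared Frobenius norm of
-- A^k, and this dominates |A^k v|²/|v|². The minimum ranges over all switching classes that meet
-- the solution set. Switching preserves eigenvalues, so it is attained on the finite list of
-- solutions, the same list over which the traces are averaged. Walks enter only through lists of
-- their parity vectors: the trace expansion, the counts N and the tree bound rest on one recursion
-- over the first step.

-- Ordered field arithmetic: a ring solver, inequalities, n-th roots and absolute values.

module OrderedField (ℝ : RealNumbers) where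

  open RealNumbers ℝ hiding (zero)
  open IsStrictTotalOrder isStrictTotalOrder
    using (<-respʳ-≈; <-respˡ-≈; irrefl)
    renaming (trans to <-trans)
  open RingProperties ring using (-‿distribˡ-*; -‿distribʳ-*; -‿involutive; -0#≈0#)
  open AbelianGroupProperties +-abelianGroup using (⁻¹-∙-comm)
  open CommutativeSemigroupProperties +-commutativeSemigroup using (interchange)
  open Mult semiring using (×-homo-+; ×1-homo-*; ×-congˡ)
  open SetoidReasoning setoid

  -- The solver's coefficients are formal differences (a , b) of naturals,
  -- standing for a - b; they are kept reduced so that equal coefficients
  -- are syntactically equal.
  private
    Difference : Set
    Difference = ℕ × ℕ

    reduce : Difference → Difference
    reduce (a , b) = a ℕ.∸ b , b ℕ.∸ a

    differences : RawRing 0ℓ 0ℓ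
    differences = record
      { Carrier = Difference
      ; _≈_ = _≡_
      ; _+_ = λ (a , b) (c , d) → reduce (a ℕ.+ c , b ℕ.+ d)
      ; _*_ = λ (a , b) (c , d) → reduce (a ℕ.* c ℕ.+ b ℕ.* d , a ℕ.* d ℕ.+ b ℕ.* c)
      ; -_  = λ (a , b) → b , a
      ; 0#  = 0 , 0
      ; 1#  = 1 , 0
      }

    value : Difference → Carrier
    value (a , b) = fromℕ a - fromℕ b

    sub-+ : ∀ a b c d → (a + c) - (b + d) ≈ (a - b) + (c - d)
    sub-+ a b c d = begin
      (a + c) - (b + d)     ≈⟨ +-congˡ (⁻¹-∙-comm b d) ⟨
      (a + c) + (- b + - d) ≈⟨ interchange _ _ _ _ ⟩
      (a - b) + (c - d)     ∎

    sub-swap : ∀ a b → b - a ≈ - (a - b)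
    sub-swap a b = begin
      b - a         ≈⟨ +-congʳ (-‿involutive b) ⟨
      - - b - a     ≈⟨ +-comm _ _ ⟩
      - a - (- b)   ≈⟨ ⁻¹-∙-comm a (- b) ⟩
      - (a - b)     ∎

    sub-* : ∀ a b c d → (a * c + b * d) - (a * d + b * c) ≈ (a - b) * (c - d)
    sub-* a b c d = begin
      (a * c + b * d) - (a * d + b * c)       ≈⟨ sub-+ _ _ _ _ ⟩
      (a * c - a * d) + (b * d - b * c)
        ≈⟨ +-cong (+-congˡ (-‿distribʳ-* a d)) (trans (sub-swap _ _) (trans (-‿cong (+-congˡ (-‿distribʳ-* b d))) (trans (-‿cong (sym (distribˡ b c (- d)))) (-‿distribˡ-* b _)))) ⟩
      (a * c + a * - d) + - b * (c - d)       ≈⟨ +-congʳ (distribˡ a c (- d)) ⟨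
      a * (c - d) + - b * (c - d)             ≈⟨ distribʳ _ _ _ ⟨
      (a - b) * (c - d)                       ∎

    value-reduce : ∀ p → value (reduce p) ≈ value p
    value-reduce (zero  , zero)  = refl
    value-reduce (zero  , suc b) = refl
    value-reduce (suc a , zero)  = refl
    value-reduce (suc a , suc b) = begin
      value (reduce (a , b))             ≈⟨ value-reduce (a , b) ⟩
      fromℕ a - fromℕ b                  ≈⟨ +-identityˡ _ ⟨
      0# + (fromℕ a - fromℕ b)           ≈⟨ +-congʳ (-‿inverseʳ 1#) ⟨
      (1# - 1#) + (fromℕ a - fromℕ b)    ≈⟨ sub-+ _ _ _ _ ⟨
      (1# + fromℕ a) - (1# + fromℕ b)    ∎

    morphism : differences -Raw-AlmostCommutative⟶ fromCommutativeRing commutativeRing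
    morphism = record
      { ⟦_⟧ = value
      ; +-homo = λ (a , b) (c , d) → trans (value-reduce (a ℕ.+ c , b ℕ.+ d)) (trans (+-cong (×-homo-+ 1# a c) (-‿cong (×-homo-+ 1# b d))) (sub-+ _ _ _ _))
      ; *-homo = λ (a , b) (c , d) → trans (value-reduce (a ℕ.* c ℕ.+ b ℕ.* d , a ℕ.* d ℕ.+ b ℕ.* c)) (trans
          (+-cong (fromℕ-pair a c b d) (-‿cong (fromℕ-pair a d b c)))
          (sub-* _ _ _ _))
      ; -‿homo = λ (a , b) → sub-swap _ _
      ; 0-homo = -‿inverseʳ 0#
      ; 1-homo = trans (+-cong (+-identityʳ 1#) -0#≈0#) (+-identityʳ 1#)
      }
      where
      fromℕ-pair : ∀ a c b d → fromℕ (a ℕ.* c ℕ.+ b ℕ.* d) ≈ fromℕ a * fromℕ c + fromℕ b * fromℕ d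
      fromℕ-pair a c b d = trans (×-homo-+ 1# (a ℕ.* c) (b ℕ.* d)) (+-cong (×1-homo-* a c) (×1-homo-* b d))

    value≟ : ∀ p q → Maybe (value p ≈ value q)
    value≟ (a , b) (c , d) with a ℕ.+ d ℕ.≟ c ℕ.+ b
    ... | no _ = nothing
    ... | yes eq = just (begin
      A - B             ≈⟨ +-identityʳ _ ⟨
      (A - B) + 0#      ≈⟨ +-congˡ (-‿inverseʳ D) ⟨
      (A - B) + (D - D) ≈⟨ sub-+ A B D D ⟨
      (A + D) - (B + D) ≈⟨ +-cong A+D≈C+B (-‿cong (+-comm B D)) ⟩
      (C + B) - (D + B) ≈⟨ sub-+ C D B B ⟩
      (C - D) + (B - B) ≈⟨ +-congˡ (-‿inverseʳ B) ⟩
      (C - D) + 0#      ≈⟨ +-identityʳ _ ⟩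
      C - D             ∎)
      where
      A = fromℕ a
      B = fromℕ b
      C = fromℕ c
      D = fromℕ d
      A+D≈C+B : A + D ≈ C + B
      A+D≈C+B = trans (sym (×-homo-+ 1# a d)) (trans (×-congˡ eq) (×-homo-+ 1# c b))

  open RingSolver differences (fromCommutativeRing commutativeRing) morphism value≟ public
    using (solve; _:=_; _:+_; _:*_; _:-_; :-_)

  module Order = StrictToNonStrict _≈_ _<_

  ≤-refl : ∀ {x} → x ≤ x
  ≤-refl = inj₂ refl

  ≤-trans : ∀ {x y z} → x ≤ y → y ≤ z → x ≤ z
  ≤-trans = Order.trans isEquivalence (<-respʳ-≈ , <-respˡ-≈) <-trans

  ≤-antisym : ∀ {x y} → x ≤ y → y ≤ x → x ≈ y
  ≤-antisym = Order.antisym isEquivalence <-trans irrefl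

  <-≤-trans : ∀ {x y z} → x < y → y ≤ z → x < z
  <-≤-trans = Order.<-≤-trans <-trans <-respʳ-≈

  ≤-<-trans : ∀ {x y z} → x ≤ y → y < z → x < z
  ≤-<-trans = Order.≤-<-trans sym <-trans <-respˡ-≈

  ≤⇒≯ : ∀ {x y} → x ≤ y → ¬ y < x
  ≤⇒≯ x≤y y<x = irrefl refl (≤-<-trans x≤y y<x)

  ≮⇒≥ : ∀ {x y} → ¬ x < y → y ≤ x
  ≮⇒≥ {x} {y} x≮y with compare x y
  ... | tri< x<y _ _ = contradiction x<y x≮y
  ... | tri≈ _ x≈y _ = inj₂ (sym x≈y)
  ... | tri> _ _ y<x = inj₁ y<x

  ≤-resp : ∀ {x x′ y y′} → x ≈ x′ → y ≈ y′ → x ≤ y → x′ ≤ y′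
  ≤-resp p q x≤y = ≤-trans (inj₂ (sym p)) (≤-trans x≤y (inj₂ q))

  <-resp : ∀ {x x′ y y′} → x ≈ x′ → y ≈ y′ → x < y → x′ < y′
  <-resp p q x<y = <-respʳ-≈ q (<-respˡ-≈ p x<y)

  +-monoˡ-≤ : ∀ {x y} z → x ≤ y → x + z ≤ y + z
  +-monoˡ-≤ z (inj₁ x<y) = inj₁ (+-monoˡ-< z x<y)
  +-monoˡ-≤ z (inj₂ x≈y) = inj₂ (+-congʳ x≈y)

  +-mono-≤ : ∀ {w x y z} → w ≤ x → y ≤ z → w + y ≤ x + z
  +-mono-≤ {w} {x} {y} {z} w≤x y≤z =
    ≤-trans (+-monoˡ-≤ y w≤x) (≤-resp (+-comm y x) (+-comm z x) (+-monoˡ-≤ x y≤z))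

  +-mono-<-≤ : ∀ {w x y z} → w < x → y ≤ z → w + y < x + z
  +-mono-<-≤ {w} {x} {y} {z} w<x y≤z =
    <-≤-trans (+-monoˡ-< y w<x) (≤-resp (+-comm y x) (+-comm z x) (+-monoˡ-≤ x y≤z))

  +-nonneg : ∀ {x y} → 0# ≤ x → 0# ≤ y → 0# ≤ x + y
  +-nonneg p q = ≤-resp (+-identityʳ 0#) refl (+-mono-≤ p q)

  +-pos-nonneg : ∀ {x y} → 0# < x → 0# ≤ y → 0# < x + y
  +-pos-nonneg p q = <-resp (+-identityʳ 0#) refl (+-mono-<-≤ p q)

  *-nonneg : ∀ {x y} → 0# ≤ x → 0# ≤ y → 0# ≤ x * y
  *-nonneg (inj₁ p) (inj₁ q) = inj₁ (*-pos p q)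
  *-nonneg (inj₁ p) (inj₂ q) = inj₂ (trans (sym (zeroʳ _)) (*-congˡ q))
  *-nonneg (inj₂ p) q        = inj₂ (trans (sym (zeroˡ _)) (*-congʳ p))

  -- Inequalities are proved by exhibiting the difference of the two sides
  -- as a visibly nonnegative (positive) expression.
  ≤-by : ∀ {x y d} → y ≈ x + d → 0# ≤ d → x ≤ y
  ≤-by {x} y≈x+d 0≤d = ≤-resp (+-identityʳ x) (sym y≈x+d) (+-mono-≤ ≤-refl 0≤d)

  <-by : ∀ {x y d} → y ≈ x + d → 0# < d → x < y
  <-by {x} {d = d} y≈x+d 0<d =
    <-resp (+-identityˡ x) (trans (+-comm d x) (sym y≈x+d)) (+-monoˡ-< x 0<d)

  sub-nonneg : ∀ {x y} → x ≤ y → 0# ≤ y - x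
  sub-nonneg {x} x≤y = ≤-resp (-‿inverseʳ x) refl (+-monoˡ-≤ (- x) x≤y)

  sub-pos : ∀ {x y} → x < y → 0# < y - x
  sub-pos {x} x<y = <-resp (-‿inverseʳ x) refl (+-monoˡ-< (- x) x<y)

  *-monoˡ-≤ : ∀ {x y z} → 0# ≤ z → x ≤ y → z * x ≤ z * y
  *-monoˡ-≤ {x} {y} {z} 0≤z x≤y =
    ≤-by (solve 3 (λ x y z → z :* y := z :* x :+ z :* (y :- x)) refl x y z)
         (*-nonneg 0≤z (sub-nonneg x≤y))

  *-mono-≤ : ∀ {w x y z} → 0# ≤ w → 0# ≤ y → w ≤ x → y ≤ z → w * y ≤ x * z
  *-mono-≤ 0≤w 0≤y w≤x y≤z = ≤-trans (*-monoˡ-≤ 0≤w y≤z)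
    (≤-resp (*-comm _ _) (*-comm _ _) (*-monoˡ-≤ (≤-trans 0≤y y≤z) w≤x))

  *-monoˡ-< : ∀ {x y z} → 0# < z → x < y → z * x < z * y
  *-monoˡ-< {x} {y} {z} 0<z x<y =
    <-by (solve 3 (λ x y z → z :* y := z :* x :+ z :* (y :- x)) refl x y z)
         (*-pos 0<z (sub-pos x<y))

  *-cancelˡ-≤ : ∀ {x y z} → 0# < z → z * x ≤ z * y → x ≤ y
  *-cancelˡ-≤ 0<z zx≤zy = ≮⇒≥ (λ y<x → ≤⇒≯ zx≤zy (*-monoˡ-< 0<z y<x))

  *-cancelˡ-< : ∀ {x y z} → 0# ≤ z → z * x < z * y → x < y
  *-cancelˡ-< {x} {y} 0≤z zx<zy with compare x y
  ... | tri< x<y _ _ = x<y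
  ... | tri≈ _ x≈y _ = contradiction zx<zy (irrefl (*-congˡ x≈y))
  ... | tri> _ _ y<x = contradiction zx<zy (≤⇒≯ (*-monoˡ-≤ 0≤z (inj₁ y<x)))

  *-cancelˡ-≈ : ∀ {x y z} → 0# < z → z * x ≈ z * y → x ≈ y
  *-cancelˡ-≈ 0<z eq = ≤-antisym (*-cancelˡ-≤ 0<z (inj₂ eq)) (*-cancelˡ-≤ 0<z (inj₂ (sym eq)))

  neg-pos : ∀ {x} → x < 0# → 0# < - x
  neg-pos {x} x<0 = <-resp refl (+-identityˡ (- x)) (sub-pos x<0)

  square-nonneg : ∀ x → 0# ≤ x * x
  square-nonneg x with compare x 0#
  ... | tri< x<0 _ _ = ≤-resp refl (solve 1 (λ x → (:- x) :* (:- x) := x :* x) refl x)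
                         (inj₁ (*-pos (neg-pos x<0) (neg-pos x<0)))
  ... | tri≈ _ x≈0 _ = inj₂ (sym (trans (*-congʳ x≈0) (zeroˡ x)))
  ... | tri> _ _ 0<x = inj₁ (*-pos 0<x 0<x)

  square-pos : ∀ {x} → ¬ x ≈ 0# → 0# < x * x
  square-pos {x} x≉0 with compare x 0#
  ... | tri< x<0 _ _ = <-resp refl (solve 1 (λ x → (:- x) :* (:- x) := x :* x) refl x)
                         (*-pos (neg-pos x<0) (neg-pos x<0))
  ... | tri≈ _ x≈0 _ = contradiction x≈0 x≉0
  ... | tri> _ _ 0<x = *-pos 0<x 0<x

  0<1 : 0# < 1#
  0<1 = <-resp refl (*-identityˡ 1#) (square-pos (λ 1≈0 → 0≉1 (sym 1≈0)))

  pos⇒≉0 : ∀ {x} → 0# < x → ¬ x ≈ 0#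
  pos⇒≉0 0<x x≈0 = irrefl (sym x≈0) 0<x

  inverse-pos : ∀ {x} → 0# < x → 0# < x ⁻¹
  inverse-pos {x} 0<x = *-cancelˡ-< (inj₁ 0<x)
    (<-resp (sym (zeroʳ x)) (sym (⁻¹-inverse x (pos⇒≉0 0<x))) 0<1)

  fromℕ-nonneg : ∀ n → 0# ≤ fromℕ n
  fromℕ-nonneg zero    = ≤-refl
  fromℕ-nonneg (suc n) = +-nonneg (inj₁ 0<1) (fromℕ-nonneg n)

  fromℕ-pos : ∀ {n} → 1 ℕ.≤ n → 0# < fromℕ n
  fromℕ-pos {suc n} _ = +-pos-nonneg 0<1 (fromℕ-nonneg n)

  fromℕ-mono : ∀ {m n} → m ℕ.≤ n → fromℕ m ≤ fromℕ n
  fromℕ-mono {n = n} z≤n = fromℕ-nonneg n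
  fromℕ-mono (s≤s m≤n)   = +-mono-≤ ≤-refl (fromℕ-mono m≤n)

  ^-nonneg : ∀ {x} n → 0# ≤ x → 0# ≤ x ^ n
  ^-nonneg zero    0≤x = inj₁ 0<1
  ^-nonneg (suc n) 0≤x = *-nonneg 0≤x (^-nonneg n 0≤x)

  ^-mono-≤ : ∀ {x y} n → 0# ≤ x → x ≤ y → x ^ n ≤ y ^ n
  ^-mono-≤ zero    0≤x x≤y = ≤-refl
  ^-mono-≤ (suc n) 0≤x x≤y = *-mono-≤ 0≤x (^-nonneg n 0≤x) x≤y (^-mono-≤ n 0≤x x≤y)

  ^-cancel-< : ∀ {x y} n → 0# ≤ y → x ^ n < y ^ n → x < y
  ^-cancel-< {x} {y} n 0≤y xⁿ<yⁿ with x <? y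
  ... | yes x<y = x<y
  ... | no  x≮y = contradiction xⁿ<yⁿ (≤⇒≯ (^-mono-≤ n 0≤y (≮⇒≥ x≮y)))

  ^-mono-< : ∀ {x y n} → 1 ℕ.≤ n → 0# ≤ x → x < y → x ^ n < y ^ n
  ^-mono-< {x} {y} {suc n} _ 0≤x x<y = ≤-<-trans
    (*-monoˡ-≤ 0≤x (^-mono-≤ n 0≤x (inj₁ x<y)))
    (<-resp (*-comm _ _) (*-comm _ _) (*-monoˡ-< (y^n-pos n) x<y))
    where
    0<y : 0# < y
    0<y = ≤-<-trans 0≤x x<y
    y^n-pos : ∀ n → 0# < y ^ n
    y^n-pos zero    = 0<1
    y^n-pos (suc n) = *-pos 0<y (y^n-pos n)

  ^-cancel-≤ : ∀ {x y n} → 1 ℕ.≤ n → 0# ≤ y → x ^ n ≤ y ^ n → x ≤ y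
  ^-cancel-≤ 1≤n 0≤y xⁿ≤yⁿ = ≮⇒≥ (λ y<x → ≤⇒≯ xⁿ≤yⁿ (^-mono-< 1≤n 0≤y y<x))

  abstract
    -- Replaces continuity of the n-th power in the construction of roots. The constant comes from
    -- bⁿ⁺¹ - aⁿ⁺¹ = b(bⁿ - aⁿ) + (b - a)aⁿ, where b ≤ M and aⁿ ≤ Mⁿ.
    ^-lipschitz : ∀ n {M} → 0# ≤ M →
                  ∃[ C ] 0# ≤ C × (∀ {a b} → 0# ≤ a → a ≤ b → b ≤ M → b ^ n ≤ a ^ n + (b - a) * C)
    ^-lipschitz zero {M} 0≤M = 0# , ≤-refl , λ {a} {b} _ _ _ →
      ≤-by refl (inj₂ (sym (zeroʳ (b - a))))
    ^-lipschitz (suc n) {M} 0≤M with ^-lipschitz n 0≤M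
    ... | C , 0≤C , bound = M ^ n + M * C , +-nonneg (^-nonneg n 0≤M) (*-nonneg 0≤M 0≤C) , step
      where
      step : ∀ {a b} → 0# ≤ a → a ≤ b → b ≤ M → b ^ suc n ≤ a ^ suc n + (b - a) * (M ^ n + M * C)
      step {a} {b} 0≤a a≤b b≤M = ≤-trans (*-monoˡ-≤ (≤-trans 0≤a a≤b) (bound 0≤a a≤b b≤M))
        (≤-by (solve 6 (λ a b aⁿ C M Mⁿ →
                a :* aⁿ :+ (b :- a) :* (Mⁿ :+ M :* C) :=
                b :* (aⁿ :+ (b :- a) :* C) :+ (b :- a) :* ((Mⁿ :- aⁿ) :+ (M :- b) :* C))
                refl a b (a ^ n) C M (M ^ n))
              (*-nonneg (sub-nonneg a≤b)
                (+-nonneg (sub-nonneg (^-mono-≤ n 0≤a (≤-trans a≤b b≤M)))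
                          (*-nonneg (sub-nonneg b≤M) 0≤C))))

  abstract
    -- The choice ε = δ/(δ + C) meets both bounds without a minimum or a case split on C = 0: from
    -- ε(δ + C) = δ follow ε ≤ 1 and εC = δ - εδ < δ.
    small : ∀ {δ C} → 0# < δ → 0# ≤ C → ∃[ ε ] 0# < ε × ε ≤ 1# × ε * C < δ
    small {δ} {C} 0<δ 0≤C = ε , 0<ε ,
      *-cancelˡ-≤ 0<δ+C (≤-by (begin
        (δ + C) * 1# ≈⟨ *-identityʳ _ ⟩
        δ + C        ≈⟨ +-congʳ ε[δ+C]≈δ ⟨
        (δ + C) * ε + C ∎) 0≤C) ,
      <-by (begin
        δ              ≈⟨ ε[δ+C]≈δ ⟨
        (δ + C) * ε    ≈⟨ solve 3 (λ δ C ε → (δ :+ C) :* ε := ε :* C :+ ε :* δ) refl δ C ε ⟩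
        ε * C + ε * δ  ∎) (*-pos 0<ε 0<δ)
      where
      0<δ+C : 0# < δ + C
      0<δ+C = +-pos-nonneg 0<δ 0≤C
      ε : Carrier
      ε = δ * (δ + C) ⁻¹
      0<ε : 0# < ε
      0<ε = *-pos 0<δ (inverse-pos 0<δ+C)
      ε[δ+C]≈δ : (δ + C) * ε ≈ δ
      ε[δ+C]≈δ = begin
        (δ + C) * (δ * (δ + C) ⁻¹)   ≈⟨ solve 3 (λ x y z → x :* (y :* z) := y :* (x :* z)) refl _ _ _ ⟩
        δ * ((δ + C) * (δ + C) ⁻¹)   ≈⟨ *-congˡ (⁻¹-inverse _ (pos⇒≉0 0<δ+C)) ⟩
        δ * 1#                       ≈⟨ *-identityʳ δ ⟩
        δ                            ∎

  ^-≥1 : ∀ {x} n → 1# ≤ x → 1# ≤ x ^ n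
  ^-≥1 zero    1≤x = ≤-refl
  ^-≥1 (suc n) 1≤x = ≤-resp (*-identityʳ 1#) refl
    (*-mono-≤ (inj₁ 0<1) (inj₁ 0<1) 1≤x (^-≥1 n 1≤x))

  private
    module Supremum {n} (1≤n : 1 ℕ.≤ n) {x} (0≤x : 0# ≤ x) where

      Below : Carrier → Set
      Below y = 0# ≤ y × y ^ n ≤ x

      0∈Below : Below 0#
      0∈Below = ≤-refl , ≤-resp (sym (0^n≈0 1≤n)) refl 0≤x
        where
        0^n≈0 : ∀ {n} → 1 ℕ.≤ n → 0# ^ n ≈ 0#
        0^n≈0 (s≤s _) = zeroˡ _

      1≤1+x : 1# ≤ 1# + x
      1≤1+x = ≤-by refl 0≤x

      -- Since 1 + x ≥ 1, its n-th power is at least 1 + x, hence at least x ≥ yⁿ, and n-th powers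
      -- reflect order.
      bounded : IsUpperBound Below (1# + x)
      bounded y (0≤y , yⁿ≤x) = ^-cancel-≤ 1≤n (≤-trans (inj₁ 0<1) 1≤1+x)
        (≤-trans yⁿ≤x (≤-trans (≤-by (+-comm 1# x) (inj₁ 0<1)) (base≤power 1≤n)))
        where
        base≤power : ∀ {n} → 1 ℕ.≤ n → 1# + x ≤ (1# + x) ^ n
        base≤power {suc n} _ = ≤-resp (*-identityʳ _) refl
          (*-monoˡ-≤ (≤-trans (inj₁ 0<1) 1≤1+x) (^-≥1 n 1≤1+x))

      module _ {s} (upper : IsUpperBound Below s) (least : ∀ b → IsUpperBound Below b → s ≤ b)
               {C} (0≤C : 0# ≤ C)
               (lipschitz : ∀ {a b} → 0# ≤ a → a ≤ b → b ≤ s + 1# → b ^ n ≤ a ^ n + (b - a) * C)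
               where

        0≤s : 0# ≤ s
        0≤s = upper 0# 0∈Below

        -- Room below x lets s grow: for small ε the Lipschitz bound keeps (s + ε)ⁿ ≤ x. That bound
        -- reaches up to s + 1, hence the demand ε ≤ 1.
        not-below : ¬ s ^ n < x
        not-below sⁿ<x with small (sub-pos sⁿ<x) 0≤C
        ... | ε , 0<ε , ε≤1 , εC<δ =
          ≤⇒≯ (upper (s + ε) (+-nonneg 0≤s (inj₁ 0<ε) , [s+ε]ⁿ≤x)) (<-by refl 0<ε)
          where
          [s+ε]ⁿ≤x : (s + ε) ^ n ≤ x
          [s+ε]ⁿ≤x = ≤-trans (lipschitz 0≤s (≤-by refl (inj₁ 0<ε)) (+-mono-≤ ≤-refl ε≤1))
            (≤-by {d = (x - s ^ n) - ε * C}
              (solve 5 (λ x sⁿ s ε C → x := (sⁿ :+ ((s :+ ε) :- s) :* C) :+ ((x :- sⁿ) :- ε :* C))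
                 refl x (s ^ n) s ε C)
              (inj₁ (sub-pos εC<δ)))

        -- Otherwise s - ε would be a smaller upper bound: an element y above it would give sⁿ ≤ yⁿ
        -- + (s - y)C ≤ x + εC < sⁿ.
        not-above : ¬ x < s ^ n
        not-above x<sⁿ with small (sub-pos x<sⁿ) 0≤C
        ... | ε , 0<ε , _ , εC<δ =
          ≤⇒≯ (least (s - ε) below) (<-by (solve 2 (λ s ε → s := (s :- ε) :+ ε) refl s ε) 0<ε)
          where
          below : IsUpperBound Below (s - ε)
          below y y∈Below@(0≤y , yⁿ≤x) = ≮⇒≥ λ s-ε<y → ≤⇒≯ (sⁿ≤x+εC s-ε<y) x+εC<sⁿ
            where
            x+εC<sⁿ : x + ε * C < s ^ n
            x+εC<sⁿ = <-by {d = (s ^ n - x) - ε * C}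
              (solve 3 (λ x sⁿ εC → sⁿ := (x :+ εC) :+ ((sⁿ :- x) :- εC)) refl x (s ^ n) (ε * C))
              (sub-pos εC<δ)
            sⁿ≤x+εC : s - ε < y → s ^ n ≤ x + ε * C
            sⁿ≤x+εC s-ε<y = ≤-trans (lipschitz 0≤y (upper y y∈Below) (≤-by refl (inj₁ 0<1)))
              (+-mono-≤ yⁿ≤x (≤-resp (*-comm C (s - y)) (*-comm C ε) (*-monoˡ-≤ 0≤C s-y≤ε)))
              where
              s-y≤ε : s - y ≤ ε
              s-y≤ε = ≤-by {d = y - (s - ε)} (solve 3 (λ s ε y → ε := (s :- y) :+ (y :- (s :- ε))) refl s ε y)
                (inj₁ (sub-pos s-ε<y))

        power≈ : s ^ n ≈ x
        power≈ = ≤-antisym (≮⇒≥ not-above) (≮⇒≥ not-below)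

  abstract
    root : ∀ {n} → 1 ℕ.≤ n → ∀ {x} → 0# ≤ x → ∃ (IsRoot n x)
    root {n} 1≤n {x} 0≤x with supremum (Supremum.Below 1≤n 0≤x) (0# , Supremum.0∈Below 1≤n 0≤x)
                                (1# + x , Supremum.bounded 1≤n 0≤x)
    ... | s , upper , least with ^-lipschitz n (+-nonneg (upper 0# (Supremum.0∈Below 1≤n 0≤x)) (inj₁ 0<1))
    ... | C , 0≤C , lipschitz = s , upper 0# (Supremum.0∈Below 1≤n 0≤x) ,
      Supremum.power≈ 1≤n 0≤x upper least 0≤C lipschitz

  ∣∣-nonneg : ∀ x → 0# ≤ ∣ x ∣
  ∣∣-nonneg x with x <? 0#
  ... | yes x<0 = inj₁ (neg-pos x<0)
  ... | no  x≮0 = ≮⇒≥ x≮0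

  ∣∣-square : ∀ x → ∣ x ∣ * ∣ x ∣ ≈ x * x
  ∣∣-square x with x <? 0#
  ... | yes _ = solve 1 (λ x → (:- x) :* (:- x) := x :* x) refl x
  ... | no  _ = refl

  nonneg-∣∣ : ∀ {x} → 0# ≤ x → ∣ x ∣ ≈ x
  nonneg-∣∣ {x} 0≤x with x <? 0#
  ... | yes x<0 = contradiction x<0 (≤⇒≯ 0≤x)
  ... | no  _   = refl

  neg-∣∣ : ∀ {x} → 0# ≤ x → ∣ - x ∣ ≈ x
  neg-∣∣ {x} 0≤x with - x <? 0#
  ... | yes _ = -‿involutive x
  ... | no -x≮0 = trans (-‿cong x≈0) (trans -0#≈0# (sym x≈0))
    where
    x≈0 : x ≈ 0#
    x≈0 = ≤-antisym (≮⇒≥ λ 0<x → -x≮0 (<-by (sym (-‿inverseˡ x)) 0<x)) 0≤x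

-- Linear algebra over 𝔽₂: spans, separating functionals, and the form π as a dot product.

module BinaryVectors where

  open ≡ using (refl; sym; trans; cong; cong₂; subst)

  ⊕-assoc : ∀ {m} (x y z : 𝔽₂^ m) → (x ⊕ y) ⊕ z ≡ x ⊕ (y ⊕ z)
  ⊕-assoc = Vec.zipWith-assoc ℙ.+-assoc

  ⊕-identityˡ : ∀ {m} (x : 𝔽₂^ m) → 𝟘 ⊕ x ≡ x
  ⊕-identityˡ = Vec.zipWith-identityˡ ℙ.+-identityˡ

  ⊕-identityʳ : ∀ {m} (x : 𝔽₂^ m) → x ⊕ 𝟘 ≡ x
  ⊕-identityʳ = Vec.zipWith-identityʳ ℙ.+-identityʳ

  ⊕-self : ∀ {m} (x : 𝔽₂^ m) → x ⊕ x ≡ 𝟘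
  ⊕-self []      = refl
  ⊕-self (p ∷ x) = cong₂ _∷_ (ℙ.p+p≡0ℙ p) (⊕-self x)

  ⊕-cancelˡ : ∀ {m} (x y : 𝔽₂^ m) → x ⊕ (x ⊕ y) ≡ y
  ⊕-cancelˡ x y = trans (sym (⊕-assoc x x y)) (trans (cong (_⊕ y) (⊕-self x)) (⊕-identityˡ y))

  open CommutativeSemigroupProperties ℙ.+-commutativeSemigroup using (interchange)

  dot-⊕ʳ : ∀ {m} (s z z′ : 𝔽₂^ m) → dot s (z ⊕ z′) ≡ dot s z ℙ.+ dot s z′
  dot-⊕ʳ []      []      []       = refl
  dot-⊕ʳ (p ∷ s) (q ∷ z) (r ∷ z′) =
    trans (cong₂ ℙ._+_ (ℙ.*-distribˡ-+ p q r) (dot-⊕ʳ s z z′)) (interchange (p ℙ.* q) (p ℙ.* r) (dot s z) (dot s z′))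

  dot-⊕ˡ : ∀ {m} (s t z : 𝔽₂^ m) → dot (s ⊕ t) z ≡ dot s z ℙ.+ dot t z
  dot-⊕ˡ []      []      []      = refl
  dot-⊕ˡ (p ∷ s) (q ∷ t) (r ∷ z) =
    trans (cong₂ ℙ._+_ (ℙ.*-distribʳ-+ r p q) (dot-⊕ˡ s t z)) (interchange (p ℙ.* r) (q ℙ.* r) (dot s z) (dot t z))

  dot-𝟘ʳ : ∀ {m} (s : 𝔽₂^ m) → dot s 𝟘 ≡ 0ℙ
  dot-𝟘ʳ []      = refl
  dot-𝟘ʳ (p ∷ s) = cong₂ ℙ._+_ (ℙ.*-zeroʳ p) (dot-𝟘ʳ s)

  dot-𝟘ˡ : ∀ {m} (z : 𝔽₂^ m) → dot 𝟘 z ≡ 0ℙ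
  dot-𝟘ˡ []      = refl
  dot-𝟘ˡ (q ∷ z) = dot-𝟘ˡ z

  𝟘∈subsetSums : ∀ {m} (gs : List (𝔽₂^ m)) → 𝟘 ∈ subsetSums gs
  𝟘∈subsetSums []       = here refl
  𝟘∈subsetSums (g ∷ gs) = ∈-++⁺ˡ (𝟘∈subsetSums gs)

  𝟘∈span : ∀ {m} (gs : List (𝔽₂^ m)) → 𝟘 ∈ span gs
  𝟘∈span gs = ∈-deduplicate⁺ _≟ᵛ_ (𝟘∈subsetSums gs)

  nonzero-detected : ∀ {m} (z : 𝔽₂^ m) → z ≡ 𝟘 ⊎ ∃[ t ] dot t z ≡ 1ℙ
  nonzero-detected []       = inj₁ refl
  nonzero-detected (1ℙ ∷ z) = inj₂ (1ℙ ∷ 𝟘 , cong (1ℙ ℙ.+_) (dot-𝟘ˡ z))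
  nonzero-detected (0ℙ ∷ z) with nonzero-detected z
  ... | inj₁ z≡𝟘      = inj₁ (cong (0ℙ ∷_) z≡𝟘)
  ... | inj₂ (t , eq) = inj₂ (0ℙ ∷ t , eq)

  Annihilates : ∀ {m} → 𝔽₂^ m → List (𝔽₂^ m) → Set
  Annihilates t gs = All (λ g → dot t g ≡ 0ℙ) gs

  -- The double annihilator theorem in decidable form, by induction on the generators. If t
  -- separates z from the span of `gs` but t · g = 1, then t must be corrected. To this end the
  -- lemma is applied to g ⊕ z: membership puts z itself into the larger span, and otherwise a
  -- second functional u is available.
  span-or-separated : ∀ {m} (gs : List (𝔽₂^ m)) z →
                      z ∈ subsetSums gs ⊎ ∃[ t ] Annihilates t gs × dot t z ≡ 1ℙ
  span-or-separated [] z with nonzero-detected z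
  ... | inj₁ z≡𝟘      = inj₁ (here z≡𝟘)
  ... | inj₂ (t , eq) = inj₂ (t , [] , eq)
  span-or-separated (g ∷ gs) z with span-or-separated gs z
  ... | inj₁ z∈ = inj₁ (∈-++⁺ˡ z∈)
  ... | inj₂ (t , t⊥gs , tz) with dot t g in tg
  ... | 0ℙ = inj₂ (t , tg ∷ t⊥gs , tz)
  ... | 1ℙ with span-or-separated gs (g ⊕ z)
  ... | inj₁ g⊕z∈ = inj₁ (∈-++⁺ʳ (subsetSums gs) (subst (_∈ _) (⊕-cancelˡ g z) (∈-map⁺ (g ⊕_) g⊕z∈)))
  ... | inj₂ (u , u⊥gs , u[g⊕z]) = combine (dot u g) (dot u z) refl refl (trans (sym (dot-⊕ʳ u g z)) u[g⊕z])
    where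
    combine : ∀ p q → dot u g ≡ p → dot u z ≡ q → dot u g ℙ.+ dot u z ≡ 1ℙ →
              z ∈ subsetSums (g ∷ gs) ⊎ ∃[ v ] Annihilates v (g ∷ gs) × dot v z ≡ 1ℙ
    combine 0ℙ q ug uz eq = inj₂ (u , ug ∷ u⊥gs , trans (cong (ℙ._+ dot u z) (sym ug)) eq)
    -- Here u · g = 1 forces u · z = 0, so t ⊕ u takes the value 1 + 1 = 0 on g and 1 + 0 = 1 on z.
    combine 1ℙ q ug uz eq = inj₂ (t ⊕ u ,
      trans (dot-⊕ˡ t u g) (cong₂ ℙ._+_ tg ug) ∷
      All.zipWith (λ {x} (tx , ux) → trans (dot-⊕ˡ t u x) (cong₂ ℙ._+_ tx ux)) (t⊥gs , u⊥gs) ,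
      trans (dot-⊕ˡ t u z) (trans (cong₂ ℙ._+_ tz uz) (cong (1ℙ ℙ.+_) q≡0)))
      where
      q≡0 : q ≡ 0ℙ
      q≡0 = ℙ.+-cancelˡ-≡ 1ℙ q 0ℙ (trans (sym (cong₂ ℙ._+_ ug uz)) eq)

  -- Two additive maps that agree on generators agree on the span. Additivity of π is known on W
  -- only, so W stays fixed while the induction shrinks `gs`, and the inclusion in W is carried
  -- along. That π vanishes at 𝟘 follows from 𝟘 ⊕ 𝟘 = 𝟘.
  constraintForm≡dot : ∀ {m} (W : List (𝔽₂^ m)) (π : 𝔽₂^ m → Parity) →
    (∀ {z z′} → z ∈ W → z′ ∈ W → π (z ⊕ z′) ≡ π z ℙ.+ π z′) →
    ∀ s gs → (∀ {z} → z ∈ subsetSums gs → z ∈ W) →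
    All (λ g → π g ≡ 1ℙ) gs → All (λ g → dot s g ≡ 1ℙ) gs →
    ∀ {z} → z ∈ subsetSums gs → π z ≡ dot s z
  constraintForm≡dot W π additive s [] gs⊆W [] [] (here refl) = trans π𝟘≡0 (sym (dot-𝟘ʳ s))
    where
    π𝟘≡0 : π 𝟘 ≡ 0ℙ
    π𝟘≡0 = ℙ.+-cancelˡ-≡ (π 𝟘) (π 𝟘) 0ℙ (trans (sym (additive (gs⊆W (here refl)) (gs⊆W (here refl))))
      (trans (cong π (⊕-self 𝟘)) (sym (ℙ.+-identityʳ (π 𝟘)))))
  constraintForm≡dot W π additive s (g ∷ gs) gs⊆W (πg ∷ πgs) (sg ∷ sgs) {z} z∈
    with ∈-++⁻ (subsetSums gs) z∈
  ... | inj₁ z∈gs = constraintForm≡dot W π additive s gs (λ p → gs⊆W (∈-++⁺ˡ p)) πgs sgs z∈gs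
  ... | inj₂ z∈g⊕gs with ∈-map⁻ (g ⊕_) z∈g⊕gs
  ... | y , y∈gs , refl = trans (additive g∈W (gs⊆W (∈-++⁺ˡ y∈gs)))
    (trans (cong₂ ℙ._+_ (trans πg (sym sg)) (constraintForm≡dot W π additive s gs (λ p → gs⊆W (∈-++⁺ˡ p)) πgs sgs y∈gs))
      (sym (dot-⊕ʳ s g y)))
    where
    g∈W : g ∈ W
    g∈W = gs⊆W (∈-++⁺ʳ (subsetSums gs) (subst (_∈ List.map (g ⊕_) (subsetSums gs)) (⊕-identityʳ g) (∈-map⁺ (g ⊕_) (𝟘∈subsetSums gs))))

-- Finite sums over lists, and sums against an indicator.

module ListSums (ℝ : RealNumbers) where

  open RealNumbers ℝ hiding (zero)
  open OrderedField ℝ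
  open CommutativeSemigroupProperties +-commutativeSemigroup using (interchange)
  open SetoidReasoning setoid

  sumOver-cong-∈ : ∀ {A : Set} (xs : List A) {f g : A → Carrier} → (∀ {x} → x ∈ xs → f x ≈ g x) →
                   sumOver xs f ≈ sumOver xs g
  sumOver-cong-∈ []       f≈g = refl
  sumOver-cong-∈ (x ∷ xs) f≈g = +-cong (f≈g (here ≡.refl)) (sumOver-cong-∈ xs (f≈g ∘ there))

  sumOver-cong : ∀ {A : Set} (xs : List A) {f g : A → Carrier} → (∀ x → f x ≈ g x) → sumOver xs f ≈ sumOver xs g
  sumOver-cong xs f≈g = sumOver-cong-∈ xs (λ {x} _ → f≈g x)

  sumOver-mono-∈ : ∀ {A : Set} (xs : List A) {f g : A → Carrier} → (∀ {x} → x ∈ xs → f x ≤ g x) →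
                   sumOver xs f ≤ sumOver xs g
  sumOver-mono-∈ []       f≤g = ≤-refl
  sumOver-mono-∈ (x ∷ xs) f≤g = +-mono-≤ (f≤g (here ≡.refl)) (sumOver-mono-∈ xs (f≤g ∘ there))

  sumOver-++ : ∀ {A : Set} (xs ys : List A) f → sumOver (xs ++ ys) f ≈ sumOver xs f + sumOver ys f
  sumOver-++ []       ys f = sym (+-identityˡ _)
  sumOver-++ (x ∷ xs) ys f = trans (+-congˡ (sumOver-++ xs ys f)) (sym (+-assoc _ _ _))

  sumOver-map : ∀ {A B : Set} (g : A → B) xs f → sumOver (map g xs) f ≡ sumOver xs (f ∘ g)
  sumOver-map g []       f = ≡.refl
  sumOver-map g (x ∷ xs) f = ≡.cong (f (g x) +_) (sumOver-map g xs f)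

  sumOver-concatMap : ∀ {A B : Set} (g : A → List B) xs f →
                      sumOver (concatMap g xs) f ≈ ∑[ x ∈ xs ] (sumOver (g x) f)
  sumOver-concatMap g []       f = refl
  sumOver-concatMap g (x ∷ xs) f = trans (sumOver-++ (g x) (concatMap g xs) f) (+-congˡ (sumOver-concatMap g xs f))

  sumOver-zero : ∀ {A : Set} (xs : List A) → sumOver xs (λ _ → 0#) ≈ 0#
  sumOver-zero []       = refl
  sumOver-zero (x ∷ xs) = trans (+-identityˡ _) (sumOver-zero xs)

  sumOver-+ : ∀ {A : Set} (xs : List A) f g → ∑[ x ∈ xs ] (f x + g x) ≈ sumOver xs f + sumOver xs g
  sumOver-+ []       f g = sym (+-identityˡ 0#)
  sumOver-+ (x ∷ xs) f g = trans (+-congˡ (sumOver-+ xs f g)) (interchange _ _ _ _)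

  sumOver-*ˡ : ∀ {A : Set} (xs : List A) c f → ∑[ x ∈ xs ] (c * f x) ≈ c * sumOver xs f
  sumOver-*ˡ []       c f = sym (zeroʳ c)
  sumOver-*ˡ (x ∷ xs) c f = trans (+-congˡ (sumOver-*ˡ xs c f)) (sym (distribˡ c _ _))

  sumOver-const : ∀ {A : Set} (xs : List A) c → ∑[ _ ∈ xs ] c ≈ fromℕ (length xs) * c
  sumOver-const []       c = sym (zeroˡ c)
  sumOver-const (x ∷ xs) c = trans (+-cong (sym (*-identityˡ c)) (sumOver-const xs c)) (sym (distribʳ c _ _))

  sumOver-comm : ∀ {A B : Set} (xs : List A) (ys : List B) (f : A → B → Carrier) →
                 ∑[ x ∈ xs ] (∑[ y ∈ ys ] f x y) ≈ ∑[ y ∈ ys ] (∑[ x ∈ xs ] f x y)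
  sumOver-comm []       ys f = sym (sumOver-zero ys)
  sumOver-comm (x ∷ xs) ys f = trans (+-congˡ (sumOver-comm xs ys f))
    (sym (sumOver-+ ys (f x) (λ y → ∑[ x′ ∈ xs ] f x′ y)))

  sumOver-filter : ∀ {A : Set} {P : Pred A 0ℓ} (P? : Decidable P) xs f →
                   sumOver (filter P? xs) f ≈ ∑[ x ∈ xs ] (if does (P? x) then f x else 0#)
  sumOver-filter P? []       f = refl
  sumOver-filter P? (x ∷ xs) f with does (P? x)
  ... | true  = +-congˡ (sumOver-filter P? xs f)
  ... | false = trans (sumOver-filter P? xs f) (sym (+-identityˡ _))

  indicator : ∀ {A : Set} → Dec A → Carrier
  indicator a? = if does a? then 1# else 0#

  module _ {m : ℕ} where
    sumOver-indicator-∉ : ∀ {xs : List (𝔽₂^ m)} (f : 𝔽₂^ m → Carrier) z → z ∉ xs → ∑[ w ∈ xs ] (f w * indicator (z ≟ᵛ w)) ≈ 0#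
    sumOver-indicator-∉ {[]}     f z z∉ = refl
    sumOver-indicator-∉ {x ∷ xs} f z z∉ with z ≟ᵛ x
    ... | yes z≡x = contradiction (here z≡x) z∉
    ... | no  _   = trans (+-cong (zeroʳ (f x)) (sumOver-indicator-∉ f z (z∉ ∘ there))) (+-identityʳ 0#)

    -- The reason for deduplicating `span`: a repeated vector would contribute with its
    -- multiplicity.
    sumOver-indicator-∈ : ∀ {xs : List (𝔽₂^ m)} (f : 𝔽₂^ m → Carrier) {z} → Unique xs → z ∈ xs →
                          ∑[ w ∈ xs ] (f w * indicator (z ≟ᵛ w)) ≈ f z
    sumOver-indicator-∈ {x ∷ xs} f {z} (x∉xs ∷ xs!) z∈ with z ≟ᵛ x | z∈
    ... | yes ≡.refl | _ = trans (+-cong (*-identityʳ (f x))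
            (sumOver-indicator-∉ f z (λ z∈xs → All.lookup x∉xs z∈xs ≡.refl))) (+-identityʳ _)
    ... | no z≢x | here z≡x   = contradiction z≡x z≢x
    ... | no z≢x | there z∈xs = trans (+-cong (zeroʳ (f x)) (sumOver-indicator-∈ f xs! z∈xs)) (+-identityˡ _)

    fromℕ-count-∷ : ∀ (z : 𝔽₂^ m) zs w → fromℕ (length (filter (_≟ᵛ w) (z ∷ zs))) ≈
                                indicator (z ≟ᵛ w) + fromℕ (length (filter (_≟ᵛ w) zs))
    fromℕ-count-∷ z zs w with does (z ≟ᵛ w)
    ... | true  = refl
    ... | false = sym (+-identityˡ _)

-- Orthogonality of characters on the affine space of solutions.

module CharacterSums (ℝ : RealNumbers) (G : SimpleGraph) where

  open RealNumbers ℝ hiding (zero)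
  open SignedGraphs ℝ G using (sign)
  open OrderedField ℝ
  open ListSums ℝ
  open BinaryVectors
  open RingProperties ring using (-‿distribˡ-*; -‿involutive)
  open SetoidReasoning setoid

  sign-+ : ∀ p q → sign (p ℙ.+ q) ≈ sign p * sign q
  sign-+ 0ℙ q  = sym (*-identityˡ _)
  sign-+ 1ℙ 0ℙ = sym (*-identityʳ _)
  sign-+ 1ℙ 1ℙ = trans (sym (-‿involutive 1#)) (trans (-‿cong (sym (*-identityˡ (- 1#)))) (-‿distribˡ-* 1# (- 1#)))

  ≈-neg⇒≈0 : ∀ {x} → x ≈ - x → x ≈ 0#
  ≈-neg⇒≈0 {x} x≈-x = *-cancelˡ-≈ {z = 1# + 1#} (+-pos-nonneg 0<1 (inj₁ 0<1)) (begin
    (1# + 1#) * x   ≈⟨ distribʳ x 1# 1# ⟩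
    1# * x + 1# * x ≈⟨ +-cong (*-identityˡ x) (trans (*-identityˡ x) x≈-x) ⟩
    x - x           ≈⟨ -‿inverseʳ x ⟩
    0#              ≈⟨ zeroʳ _ ⟨
    (1# + 1#) * 0#  ∎)

  allVectors : ∀ m → List (𝔽₂^ m)
  allVectors = vectors (0ℙ ∷ 1ℙ ∷ [])

  sumOver-allVectors-suc : ∀ m (f : 𝔽₂^ (suc m) → Carrier) → sumOver (allVectors (suc m)) f ≈
                 sumOver (allVectors m) (f ∘ (0ℙ ∷_)) + sumOver (allVectors m) (f ∘ (1ℙ ∷_))
  sumOver-allVectors-suc m f = begin
    sumOver (map (0ℙ ∷_) (allVectors m) ++ (map (1ℙ ∷_) (allVectors m) ++ [])) f
      ≈⟨ sumOver-++ (map (0ℙ ∷_) (allVectors m)) _ f ⟩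
    sumOver (map (0ℙ ∷_) (allVectors m)) f + sumOver (map (1ℙ ∷_) (allVectors m) ++ []) f
      ≈⟨ +-cong (reflexive (sumOver-map (0ℙ ∷_) (allVectors m) f))
           (trans (reflexive (≡.cong (λ xs → sumOver xs f) (List.++-identityʳ (map (1ℙ ∷_) (allVectors m)))))
                  (reflexive (sumOver-map (1ℙ ∷_) (allVectors m) f))) ⟩
    sumOver (allVectors m) (f ∘ (0ℙ ∷_)) + sumOver (allVectors m) (f ∘ (1ℙ ∷_)) ∎

  -- Coordinate by coordinate: a leading 0 keeps the two halves of the enumeration in place and a
  -- leading 1 exchanges them, so commutativity of one addition replaces a permutation argument.
  sumOver-shift : ∀ {m} (t : 𝔽₂^ m) f → ∑[ s ∈ allVectors m ] f (t ⊕ s) ≈ sumOver (allVectors m) f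
  sumOver-shift []       f = refl
  sumOver-shift {suc m} (0ℙ ∷ t) f = begin
    sumOver (allVectors (suc m)) (λ s → f ((0ℙ ∷ t) ⊕ s))
      ≈⟨ sumOver-allVectors-suc m _ ⟩
    ∑[ s ∈ allVectors m ] f (0ℙ ∷ (t ⊕ s)) + ∑[ s ∈ allVectors m ] f (1ℙ ∷ (t ⊕ s))
      ≈⟨ +-cong (sumOver-shift t (f ∘ (0ℙ ∷_))) (sumOver-shift t (f ∘ (1ℙ ∷_))) ⟩
    sumOver (allVectors m) (f ∘ (0ℙ ∷_)) + sumOver (allVectors m) (f ∘ (1ℙ ∷_))
      ≈⟨ sumOver-allVectors-suc m f ⟨
    sumOver (allVectors (suc m)) f ∎
  sumOver-shift {suc m} (1ℙ ∷ t) f = begin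
    sumOver (allVectors (suc m)) (λ s → f ((1ℙ ∷ t) ⊕ s))
      ≈⟨ sumOver-allVectors-suc m _ ⟩
    ∑[ s ∈ allVectors m ] f (1ℙ ∷ (t ⊕ s)) + ∑[ s ∈ allVectors m ] f (0ℙ ∷ (t ⊕ s))
      ≈⟨ +-cong (sumOver-shift t (f ∘ (1ℙ ∷_))) (sumOver-shift t (f ∘ (0ℙ ∷_))) ⟩
    sumOver (allVectors m) (f ∘ (1ℙ ∷_)) + sumOver (allVectors m) (f ∘ (0ℙ ∷_))
      ≈⟨ +-comm _ _ ⟩
    sumOver (allVectors m) (f ∘ (0ℙ ∷_)) + sumOver (allVectors m) (f ∘ (1ℙ ∷_))
      ≈⟨ sumOver-allVectors-suc m f ⟨
    sumOver (allVectors (suc m)) f ∎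

  module _ {m : ℕ} (gs : List (𝔽₂^ m)) where

    open DecMembership (_≟ᵛ_ {m}) using (_∈?_)

    Solution : 𝔽₂^ m → Set
    Solution s = All (λ g → dot s g ≡ 1ℙ) gs

    solution? : Decidable Solution
    solution? s = All.all? (λ g → dot s g ℙ.≟ 1ℙ) gs

    solutions : List (𝔽₂^ m)
    solutions = filter solution? (allVectors m)

    annihilator-shift : ∀ t → Annihilates t gs → ∀ s → Solution s → Solution (t ⊕ s)
    annihilator-shift t t⊥gs s sol = All.zipWith
      (λ {g} (tg , sg) → ≡.trans (dot-⊕ˡ t s g) (≡.cong₂ ℙ._+_ tg sg)) (t⊥gs , sol)

    character-sum-∉ : ∀ z → z ∉ span gs → ∑[ s ∈ solutions ] sign (dot s z) ≈ 0#
    character-sum-∉ z z∉ with span-or-separated gs z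
    ... | inj₁ z∈ = contradiction (∈-deduplicate⁺ _≟ᵛ_ z∈) z∉
    ... | inj₂ (t , t⊥gs , tz≡1) = ≈-neg⇒≈0 (begin
      ∑[ s ∈ solutions ] sign (dot s z)       ≈⟨ sumOver-filter solution? (allVectors m) (λ s → sign (dot s z)) ⟩
      sumOver (allVectors m) h                ≈⟨ sumOver-shift t h ⟨
      ∑[ s ∈ allVectors m ] h (t ⊕ s)         ≈⟨ sumOver-cong (allVectors m) h-odd ⟩
      ∑[ s ∈ allVectors m ] (- 1# * h s)      ≈⟨ sumOver-*ˡ (allVectors m) (- 1#) h ⟩
      - 1# * sumOver (allVectors m) h         ≈⟨ trans (sym (-‿distribˡ-* 1# _)) (-‿cong (*-identityˡ _)) ⟩
      - sumOver (allVectors m) h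
        ≈⟨ -‿cong (sumOver-filter solution? (allVectors m) (λ s → sign (dot s z))) ⟨
      - (∑[ s ∈ solutions ] sign (dot s z))   ∎)
      where
      h : 𝔽₂^ m → Carrier
      h s = if does (solution? s) then sign (dot s z) else 0#
      h-odd : ∀ s → h (t ⊕ s) ≈ - 1# * h s
      h-odd s with solution? s | solution? (t ⊕ s)
      ... | yes _   | yes _    = trans (reflexive (≡.cong sign (≡.trans (dot-⊕ˡ t s z) (≡.cong (ℙ._+ dot s z) tz≡1)))) (sign-+ 1ℙ (dot s z))
      ... | no _    | no _     = sym (zeroʳ _)
      ... | yes sol | no ¬sol  = contradiction (annihilator-shift t t⊥gs s sol) ¬sol
      -- Shifting by t is an involution, so it reflects solutions as well as preserving them.
      ... | no ¬sol | yes sol  = contradiction (≡.subst Solution (⊕-cancelˡ t s) (annihilator-shift t t⊥gs (t ⊕ s) sol)) ¬sol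

    module _ (π : 𝔽₂^ m → Parity) (π≡dot : ∀ s → Solution s → ∀ {z} → z ∈ span gs → π z ≡ dot s z) where

      -- The sum against `indicator` merges the cases inside and outside the span. It is a formula
      -- that can be added up over a list of vectors z, where the indicators accumulate to
      -- multiplicities.
      character-sum : ∀ z → ∑[ s ∈ solutions ] sign (dot s z) ≈
                            fromℕ (length solutions) * ∑[ w ∈ span gs ] (sign (π w) * indicator (z ≟ᵛ w))
      character-sum z with z ∈? span gs
      ... | no z∉  = trans (character-sum-∉ z z∉)
        (sym (trans (*-congˡ (sumOver-indicator-∉ (λ w → sign (π w)) z z∉)) (zeroʳ _)))
      ... | yes z∈ = begin
        ∑[ s ∈ solutions ] sign (dot s z)
          ≈⟨ sumOver-cong-∈ solutions (λ {s} s∈ → reflexive (≡.cong sign (≡.sym (π≡dot s (proj₂ (∈-filter⁻ solution? {xs = allVectors m} s∈)) z∈)))) ⟩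
        ∑[ _ ∈ solutions ] sign (π z)             ≈⟨ sumOver-const solutions (sign (π z)) ⟩
        fromℕ (length solutions) * sign (π z)
          ≈⟨ *-congˡ (sumOver-indicator-∈ (λ w → sign (π w)) (deduplicate-! _≟ᵛ_ (subsetSums gs)) z∈) ⟨
        fromℕ (length solutions) * ∑[ w ∈ span gs ] (sign (π w) * indicator (z ≟ᵛ w)) ∎

      character-sum-list : ∀ (zs : List (𝔽₂^ m)) →
        ∑[ s ∈ solutions ] (∑[ z ∈ zs ] sign (dot s z)) ≈
        fromℕ (length solutions) * ∑[ w ∈ span gs ] (sign (π w) * fromℕ (length (filter (_≟ᵛ w) zs)))
      character-sum-list zs = trans (sumOver-comm solutions zs (λ s z → sign (dot s z))) (go zs)
        where
        K : Carrier
        K = fromℕ (length solutions)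
        go : ∀ zs → ∑[ z ∈ zs ] (∑[ s ∈ solutions ] sign (dot s z)) ≈
                    K * ∑[ w ∈ span gs ] (sign (π w) * fromℕ (length (filter (_≟ᵛ w) zs)))
        go [] = sym (trans (*-congˡ (trans (sumOver-cong (span gs) (λ w → zeroʳ _)) (sumOver-zero (span gs)))) (zeroʳ K))
        go (z ∷ zs) = begin
          ∑[ s ∈ solutions ] sign (dot s z) + ∑[ z ∈ zs ] (∑[ s ∈ solutions ] sign (dot s z))
            ≈⟨ +-cong (character-sum z) (go zs) ⟩
          K * S₁ + K * S₂
            ≈⟨ distribˡ K S₁ S₂ ⟨
          K * (S₁ + S₂)
            ≈⟨ *-congˡ (sumOver-+ (span gs) _ _) ⟨
          K * ∑[ w ∈ span gs ] (sign (π w) * indicator (z ≟ᵛ w) + sign (π w) * fromℕ (length (filter (_≟ᵛ w) zs)))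
            ≈⟨ *-congˡ (sumOver-cong (span gs) (λ w → trans (sym (distribˡ _ _ _)) (*-congˡ (sym (fromℕ-count-∷ z zs w))))) ⟩
          K * ∑[ w ∈ span gs ] (sign (π w) * fromℕ (length (filter (_≟ᵛ w) (z ∷ zs)))) ∎
          where
          S₁ S₂ : Carrier
          S₁ = ∑[ w ∈ span gs ] (sign (π w) * indicator (z ≟ᵛ w))
          S₂ = ∑[ w ∈ span gs ] (sign (π w) * fromℕ (length (filter (_≟ᵛ w) zs)))

-- Cauchy-Schwarz and the trichotomy for real symmetric matrices.

module LinearAlgebra (ℝ : RealNumbers) where

  open RealNumbers ℝ hiding (zero)
  open OrderedField ℝ
  open IsStrictTotalOrder isStrictTotalOrder using (_≟_)
  open CommutativeMonoidSum +-commutativeMonoid using (sum-cong-≋; ∑-distrib-+; sum-replicate-zero)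
  open SemiringSum semiring using (*-distribˡ-sum)
  open SetoidReasoning setoid

  infixl 7 _∙_
  infixr 8 _⊛_

  _∙_ : ∀ {n} → Vector Carrier n → Vector Carrier n → Carrier
  u ∙ v = sum (λ i → u i * v i)

  _⊛_ : ∀ {n} → Matrix n → Vector Carrier n → Vector Carrier n
  (A ⊛ v) i = A i ∙ v

  Symmetric : ∀ {n} → Matrix n → Set
  Symmetric A = ∀ i j → A i j ≈ A j i

  NonZero : ∀ {n} → Vector Carrier n → Set
  NonZero v = ∃[ i ] ¬ v i ≈ 0#

  sum-cong : ∀ {n} {f g : Vector Carrier n} → (∀ i → f i ≈ g i) → sum f ≈ sum g
  sum-cong {n} = sum-cong-≋ {n}

  sum-zero : ∀ {n} {f : Vector Carrier n} → (∀ i → f i ≈ 0#) → sum f ≈ 0#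
  sum-zero {n} f≈0 = trans (sum-cong f≈0) (sum-replicate-zero n)

  sum-nonneg : ∀ {n} {f : Vector Carrier n} → (∀ i → 0# ≤ f i) → 0# ≤ sum f
  sum-nonneg {zero}  0≤f = ≤-refl
  sum-nonneg {suc n} 0≤f = +-nonneg (0≤f zero) (sum-nonneg (0≤f ∘ suc))

  sum-mono : ∀ {n} {f g : Vector Carrier n} → (∀ i → f i ≤ g i) → sum f ≤ sum g
  sum-mono {zero}  f≤g = ≤-refl
  sum-mono {suc n} f≤g = +-mono-≤ (f≤g zero) (sum-mono (f≤g ∘ suc))

  term≤sum : ∀ {n} {f : Vector Carrier n} → (∀ i → 0# ≤ f i) → ∀ i → f i ≤ sum f
  term≤sum 0≤f zero    = ≤-by refl (sum-nonneg (0≤f ∘ suc))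
  term≤sum 0≤f (suc i) = ≤-trans (term≤sum (0≤f ∘ suc) i) (≤-by (+-comm _ _) (0≤f zero))

  ∙-cong : ∀ {n} {u u′ v v′ : Vector Carrier n} →
           (∀ i → u i ≈ u′ i) → (∀ i → v i ≈ v′ i) → u ∙ v ≈ u′ ∙ v′
  ∙-cong u≈u′ v≈v′ = sum-cong (λ i → *-cong (u≈u′ i) (v≈v′ i))

  ∙-comm : ∀ {n} (u v : Vector Carrier n) → u ∙ v ≈ v ∙ u
  ∙-comm u v = sum-cong (λ i → *-comm (u i) (v i))

  ∙-scaleˡ : ∀ {n} c (u v : Vector Carrier n) → (λ i → c * u i) ∙ v ≈ c * (u ∙ v)
  ∙-scaleˡ c u v = trans (sum-cong (λ i → *-assoc c (u i) (v i))) (sym (*-distribˡ-sum c (λ i → u i * v i)))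

  ∙-scaleʳ : ∀ {n} c (u v : Vector Carrier n) → u ∙ (λ i → c * v i) ≈ c * (u ∙ v)
  ∙-scaleʳ c u v = trans (∙-comm u _) (trans (∙-scaleˡ c v u) (*-congˡ (∙-comm v u)))

  ∙-distribˡ : ∀ {n} (u v w : Vector Carrier n) → u ∙ (λ i → v i + w i) ≈ u ∙ v + u ∙ w
  ∙-distribˡ u v w = trans (sum-cong (λ i → distribˡ (u i) (v i) (w i)))
    (∑-distrib-+ (λ i → u i * v i) (λ i → u i * w i))

  ∙-distribʳ : ∀ {n} (u v w : Vector Carrier n) → (λ i → v i + w i) ∙ u ≈ v ∙ u + w ∙ u
  ∙-distribʳ u v w = trans (∙-comm _ u) (trans (∙-distribˡ u v w) (+-cong (∙-comm u v) (∙-comm u w)))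

  ∙-zeroʳ : ∀ {n} (u : Vector Carrier n) → u ∙ (λ _ → 0#) ≈ 0#
  ∙-zeroʳ u = sum-zero (λ i → zeroʳ (u i))

  ∙-self-nonneg : ∀ {n} (v : Vector Carrier n) → 0# ≤ v ∙ v
  ∙-self-nonneg v = sum-nonneg (λ i → square-nonneg (v i))

  ∙-self-pos : ∀ {n} {v : Vector Carrier n} → NonZero v → 0# < v ∙ v
  ∙-self-pos {v = v} (i , vᵢ≉0) = <-≤-trans (square-pos vᵢ≉0) (term≤sum (λ j → square-nonneg (v j)) i)

  nonZero? : ∀ {n} (v : Vector Carrier n) → Dec (NonZero v)
  nonZero? v = Fin.any? (λ i → ¬? (v i ≟ 0#))

  ¬nonZero⇒≈0 : ∀ {n} {v : Vector Carrier n} → ¬ NonZero v → ∀ i → v i ≈ 0#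
  ¬nonZero⇒≈0 {v = v} v≈0 i = decidable-stable (v i ≟ 0#) (λ vᵢ≉0 → v≈0 (i , vᵢ≉0))

  quad : ∀ {n} → Matrix n → Vector Carrier n → Carrier
  quad M v = v ∙ M ⊛ v

  -- With x and y the leading coordinates of u and v, and the vectors replaced by their tails, this
  -- is the amount by which the deficit in Cauchy-Schwarz grows when one coordinate is added, as in
  -- Lagrange's identity.
  gap-identity : ∀ {n} x y (u v : Vector Carrier n) →
                 sum (λ i → (x * v i - y * u i) * (x * v i - y * u i)) ≈
                 (x * x * (v ∙ v) + y * y * (u ∙ u)) - (x * y * (u ∙ v) + x * y * (u ∙ v))
  gap-identity {zero}  x y u v = sym (trans
    -- The empty sums are treated as one indeterminate `o`, which factors out and is then
    -- specialised to 0.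
    (solve 3 (λ x y o → (x :* x :* o :+ y :* y :* o) :- (x :* y :* o :+ x :* y :* o) :=
                        ((x :* x :+ y :* y) :- (x :* y :+ x :* y)) :* o) refl x y 0#)
    (zeroʳ _))
  gap-identity {suc n} x y u v = trans (+-congˡ (gap-identity x y (u ∘ suc) (v ∘ suc)))
    (solve 7 (λ x y u v U V P →
      (x :* v :- y :* u) :* (x :* v :- y :* u) :+ ((x :* x :* V :+ y :* y :* U) :- (x :* y :* P :+ x :* y :* P)) :=
      (x :* x :* (v :* v :+ V) :+ y :* y :* (u :* u :+ U)) :- (x :* y :* (u :* v :+ P) :+ x :* y :* (u :* v :+ P)))
      refl x y (u zero) (v zero) ((u ∘ suc) ∙ (u ∘ suc)) ((v ∘ suc) ∙ (v ∘ suc)) ((u ∘ suc) ∙ (v ∘ suc)))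

  cauchy-schwarz : ∀ {n} (u v : Vector Carrier n) → (u ∙ v) * (u ∙ v) ≤ (u ∙ u) * (v ∙ v)
  cauchy-schwarz {zero}  u v = inj₂ refl
  cauchy-schwarz {suc n} u v = ≤-by
    (solve 5 (λ x y U V P →
      (x :* x :+ U) :* (y :* y :+ V) :=
      (x :* y :+ P) :* (x :* y :+ P) :+
      (((x :* x :* V :+ y :* y :* U) :- (x :* y :* P :+ x :* y :* P)) :+ (U :* V :- P :* P)))
      refl (u zero) (v zero) (u′ ∙ u′) (v′ ∙ v′) (u′ ∙ v′))
    (+-nonneg
      (≤-resp refl (gap-identity (u zero) (v zero) u′ v′)
        (sum-nonneg {f = λ i → (u zero * v′ i - v zero * u′ i) * (u zero * v′ i - v zero * u′ i)}
          (λ i → square-nonneg _)))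
      (sub-nonneg (cauchy-schwarz u′ v′)))
    where
    u′ v′ : Vector Carrier n
    u′ = u ∘ suc
    v′ = v ∘ suc

  -- Coercivity has the constant c/K; keeping numerator and denominator apart lets the elimination
  -- step update them without division. The alternatives may overlap: diag(-1, 0) is both negative
  -- somewhere and singular.
  data Definiteness {n} (M : Matrix n) : Set where
    coercive : ∀ c K → 0# < c → 0# < K → (∀ v → c * (v ∙ v) ≤ K * quad M v) → Definiteness M
    negative : ∀ v → quad M v < 0# → Definiteness M
    singular : ∀ v → NonZero v → (∀ i → (M ⊛ v) i ≈ 0#) → Definiteness M

  private
    module Block {n} (M : Matrix (suc n)) (M-sym : Symmetric M) where

      a : Carrier
      a = M zero zero

      b : Vector Carrier n
      b i = M zero (suc i)

      C schur : Matrix n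
      C i j = M (suc i) (suc j)
      -- a times the Schur complement of the corner, which avoids division.
      schur i j = a * C i j + - (b i * b j)

      schur-sym : Symmetric schur
      schur-sym i j = +-cong (*-congˡ (M-sym (suc i) (suc j))) (-‿cong (*-comm (b i) (b j)))

      ⊛-suc : ∀ v i → (M ⊛ v) (suc i) ≈ b i * v zero + (C ⊛ (v ∘ suc)) i
      ⊛-suc v i = +-congʳ (*-congʳ (M-sym (suc i) zero))

      schur-⊛ : ∀ v i → (schur ⊛ v) i ≈ a * (C ⊛ v) i - b i * (b ∙ v)
      schur-⊛ v i = begin
        sum (λ j → (a * C i j - b i * b j) * v j)
          ≈⟨ ∙-distribʳ v (λ j → a * C i j) (λ j → - (b i * b j)) ⟩
        (λ j → a * C i j) ∙ v + (λ j → - (b i * b j)) ∙ v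
          ≈⟨ +-cong (∙-scaleˡ a (C i) v) (∙-cong {v = v} (λ j → solve 2 (λ x y → :- (x :* y) := (:- x) :* y) refl (b i) (b j)) (λ _ → refl)) ⟩
        a * (C ⊛ v) i + (λ j → - b i * b j) ∙ v                     ≈⟨ +-congˡ (∙-scaleˡ (- b i) b v) ⟩
        a * (C ⊛ v) i + - b i * (b ∙ v)
          ≈⟨ solve 3 (λ x y z → x :+ (:- y) :* z := x :- y :* z) refl _ _ _ ⟩
        a * (C ⊛ v) i - b i * (b ∙ v)                               ∎

      quad-block : ∀ v → let v₀ = v zero; v′ = v ∘ suc in
                   quad M v ≈ (a * (v₀ * v₀) + (v₀ * (b ∙ v′) + v₀ * (b ∙ v′))) + quad C v′
      quad-block v = begin
        v₀ * (a * v₀ + b ∙ v′) + v′ ∙ (λ i → (M ⊛ v) (suc i))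
          ≈⟨ +-congˡ (∙-cong {u = v′} (λ _ → refl) (⊛-suc v)) ⟩
        v₀ * (a * v₀ + b ∙ v′) + v′ ∙ (λ i → b i * v₀ + (C ⊛ v′) i)
          ≈⟨ +-congˡ (∙-distribˡ v′ (λ i → b i * v₀) (C ⊛ v′)) ⟩
        v₀ * (a * v₀ + b ∙ v′) + (v′ ∙ (λ i → b i * v₀) + quad C v′)
          ≈⟨ +-congˡ (+-congʳ (trans (∙-cong {u = v′} (λ _ → refl) (λ i → *-comm (b i) v₀))
               (trans (∙-scaleʳ v₀ v′ b) (*-congˡ (∙-comm v′ b))))) ⟩
        v₀ * (a * v₀ + b ∙ v′) + (v₀ * (b ∙ v′) + quad C v′)
          ≈⟨ solve 4 (λ a v β q → v :* (a :* v :+ β) :+ (v :* β :+ q) :=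
                                  (a :* (v :* v) :+ (v :* β :+ v :* β)) :+ q) refl a v₀ (b ∙ v′) (quad C v′) ⟩
        (a * (v₀ * v₀) + (v₀ * (b ∙ v′) + v₀ * (b ∙ v′))) + quad C v′ ∎
        where
        v₀ : Carrier
        v₀ = v zero
        v′ : Vector Carrier n
        v′ = v ∘ suc

      quad-schur : ∀ v → quad schur v ≈ a * quad C v - (b ∙ v) * (b ∙ v)
      quad-schur v = begin
        v ∙ schur ⊛ v
          ≈⟨ ∙-cong {u = v} (λ _ → refl) (λ i → trans (schur-⊛ v i)
               (+-congˡ (solve 2 (λ x y → :- (x :* y) := (:- y) :* x) refl (b i) (b ∙ v)))) ⟩
        v ∙ (λ i → a * (C ⊛ v) i + - (b ∙ v) * b i)
          ≈⟨ ∙-distribˡ v (λ i → a * (C ⊛ v) i) (λ i → - (b ∙ v) * b i) ⟩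
        v ∙ (λ i → a * (C ⊛ v) i) + v ∙ (λ i → - (b ∙ v) * b i)
          ≈⟨ +-cong (∙-scaleʳ a v (C ⊛ v)) (trans (∙-scaleʳ (- (b ∙ v)) v b) (*-congˡ (∙-comm v b))) ⟩
        a * quad C v + - (b ∙ v) * (b ∙ v)
          ≈⟨ solve 2 (λ x y → x :+ (:- y) :* y := x :- y :* y) refl _ _ ⟩
        a * quad C v - (b ∙ v) * (b ∙ v) ∎

      -- The usual completion of the square, multiplied by the pivot. All information about M is
      -- moved to and from `schur` through this identity.
      completed-square : ∀ v → let u = a * v zero + b ∙ (v ∘ suc) in
                         a * quad M v ≈ u * u + quad schur (v ∘ suc)
      completed-square v = trans (*-congˡ (quad-block v)) (trans
        (solve 4 (λ a v β q → a :* ((a :* (v :* v) :+ (v :* β :+ v :* β)) :+ q) :=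
                   (a :* v :+ β) :* (a :* v :+ β) :+ (a :* q :- β :* β))
          refl a (v zero) (b ∙ (v ∘ suc)) (quad C (v ∘ suc)))
        (+-congˡ (sym (quad-schur (v ∘ suc)))))

      -- The leading coordinate is the one that makes the square in `completed-square` vanish; it
      -- would be -(b ∙ v)/a, and scaling the whole vector by `a` clears the denominator.
      lift : Vector Carrier n → Vector Carrier (suc n)
      lift v zero    = - (b ∙ v)
      lift v (suc i) = a * v i

      quad-scale : ∀ v → quad schur (λ i → a * v i) ≈ (a * a) * quad schur v
      quad-scale v = trans (∙-cong {u = λ i → a * v i} (λ _ → refl) (λ i → ∙-scaleʳ a (schur i) v))
        (trans (∙-scaleˡ a v _) (trans (*-congˡ (∙-scaleʳ a v (schur ⊛ v))) (sym (*-assoc a a _))))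

      quad-lift : 0# < a → ∀ v → quad schur v < 0# → quad M (lift v) < 0#
      quad-lift 0<a v q<0 = *-cancelˡ-< (inj₁ 0<a) (<-resp (sym eq) (sym (zeroʳ a))
        (<-resp refl (zeroʳ (a * a)) (*-monoˡ-< (*-pos 0<a 0<a) q<0)))
        where
        eq : a * quad M (lift v) ≈ (a * a) * quad schur v
        eq = begin
          a * quad M (lift v)
            ≈⟨ completed-square (lift v) ⟩
          (a * (- (b ∙ v)) + b ∙ (λ i → a * v i)) * (a * (- (b ∙ v)) + b ∙ (λ i → a * v i)) + quad schur (λ i → a * v i)
            ≈⟨ +-cong (*-cong (+-congˡ (∙-scaleʳ a b v)) (+-congˡ (∙-scaleʳ a b v))) (quad-scale v) ⟩
          (a * (- (b ∙ v)) + a * (b ∙ v)) * (a * (- (b ∙ v)) + a * (b ∙ v)) + (a * a) * quad schur v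
            ≈⟨ solve 3 (λ a β q → (a :* (:- β) :+ a :* β) :* (a :* (:- β) :+ a :* β) :+ (a :* a) :* q := (a :* a) :* q) refl _ _ _ ⟩
          (a * a) * quad schur v ∎

      singular-lift : 0# < a → ∀ v → (∀ i → (schur ⊛ v) i ≈ 0#) → ∀ i → (M ⊛ lift v) i ≈ 0#
      singular-lift 0<a v Sv≈0 zero = begin
        a * - (b ∙ v) + b ∙ (λ i → a * v i) ≈⟨ +-congˡ (∙-scaleʳ a b v) ⟩
        a * - (b ∙ v) + a * (b ∙ v)         ≈⟨ distribˡ a _ _ ⟨
        a * (- (b ∙ v) + b ∙ v)             ≈⟨ *-congˡ (-‿inverseˡ (b ∙ v)) ⟩
        a * 0#                              ≈⟨ zeroʳ a ⟩
        0#                                  ∎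
      singular-lift 0<a v Sv≈0 (suc i) = begin
        (M ⊛ lift v) (suc i)                      ≈⟨ ⊛-suc (lift v) i ⟩
        b i * - (b ∙ v) + C i ∙ (λ j → a * v j)   ≈⟨ +-congˡ (∙-scaleʳ a (C i) v) ⟩
        b i * - (b ∙ v) + a * (C i ∙ v)
          ≈⟨ solve 4 (λ b β a γ → b :* (:- β) :+ a :* γ := a :* γ :- b :* β) refl _ _ _ _ ⟩
        a * (C ⊛ v) i - b i * (b ∙ v)             ≈⟨ schur-⊛ v i ⟨
        (schur ⊛ v) i                             ≈⟨ Sv≈0 i ⟩
        0#                                        ∎

      nonZero-lift : 0# < a → ∀ v → NonZero v → NonZero (lift v)
      nonZero-lift 0<a v (i , vᵢ≉0) = suc i , λ avᵢ≈0 →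
        vᵢ≉0 (*-cancelˡ-≈ 0<a (trans avᵢ≈0 (sym (zeroʳ a))))

      -- Write u = a v₀ + β with β = b ∙ v′. Then a²v₀² = (u - β)² ≤ 2u² + 2β² and β² ≤ B|v′|², so
      -- ca²|v|² ≤ 2cu² + (2B + a²)c|v′|². The hypothesis replaces c|v′|² by K times the Schur form
      -- at v′, and u² plus that form is a times the form of M. The sum of both coefficients, times
      -- a, is the new K.
      coercive-lift : ∀ c K → 0# < c → 0# < K → (∀ v → c * (v ∙ v) ≤ K * quad schur v) →
                      ∀ v → let B = b ∙ b in
                      (c * (a * a)) * (v ∙ v) ≤ ((c + c) * a + ((B + B) + a * a) * K * a) * quad M v
      coercive-lift c K 0<c 0<K bound v = ≤-by
        (begin
          ((c + c) * a + ((B + B) + a * a) * K * a) * quad M v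
            ≈⟨ solve 5 (λ c a B K q → ((c :+ c) :* a :+ ((B :+ B) :+ a :* a) :* K :* a) :* q :=
                                       ((c :+ c) :+ ((B :+ B) :+ a :* a) :* K) :* (a :* q))
                 refl c a B K (quad M v) ⟩
          ((c + c) + ((B + B) + a * a) * K) * (a * quad M v)
            ≈⟨ *-congˡ (completed-square v) ⟩
          ((c + c) + ((B + B) + a * a) * K) * (u * u + quad schur v′)
            ≈⟨ solve 5 (λ c D K w q → ((c :+ c) :+ D :* K) :* (w :+ q) :=
                 ((c :+ c) :* w :+ D :* (K :* q)) :+ (D :* K :* w :+ (c :+ c) :* q))
                 refl c ((B + B) + a * a) K (u * u) (quad schur v′) ⟩
          ((c + c) * (u * u) + ((B + B) + a * a) * (K * quad schur v′)) + (((B + B) + a * a) * K * (u * u) + (c + c) * quad schur v′)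
            ≈⟨ +-congʳ (solve 7 (λ c a x β B k N →
                 (c :+ c) :* ((a :* x :+ β) :* (a :* x :+ β)) :+ ((B :+ B) :+ a :* a) :* k :=
                 (c :* (a :* a)) :* (x :* x :+ N) :+
                   (c :* ((a :* x :+ (β :+ β)) :* (a :* x :+ (β :+ β))) :+
                    (((c :+ c) :* (B :* N :- β :* β)) :+ ((B :+ B) :+ a :* a) :* (k :- c :* N))))
                 refl c a (v zero) (b ∙ v′) B (K * quad schur v′) (v′ ∙ v′)) ⟩
          ((c * (a * a)) * (v ∙ v) + slack₁) + slack₂
            ≈⟨ +-assoc _ _ _ ⟩
          (c * (a * a)) * (v ∙ v) + (slack₁ + slack₂) ∎)
        (+-nonneg
          (+-nonneg (*-nonneg (inj₁ 0<c) (square-nonneg _))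
            (+-nonneg (*-nonneg 0≤c+c (sub-nonneg (cauchy-schwarz b v′)))
                      (*-nonneg 0≤D (sub-nonneg (bound v′)))))
          (+-nonneg (*-nonneg (*-nonneg 0≤D (inj₁ 0<K)) (square-nonneg _)) (*-nonneg 0≤c+c 0≤q)))
        where
        v′ : Vector Carrier n
        v′ = v ∘ suc
        B u w slack₁ slack₂ : Carrier
        B = b ∙ b
        u = a * v zero + b ∙ v′
        -- This is u + β, whose square is the deficit 2u² + 2β² - (u - β)². The remaining terms of
        -- `slack₁` are the deficits of Cauchy-Schwarz and of the hypothesis, and `slack₂` collects
        -- the cross terms from adding the two coefficients.
        w = a * v zero + (b ∙ v′ + b ∙ v′)
        slack₁ = c * (w * w) + ((c + c) * (B * (v′ ∙ v′) - (b ∙ v′) * (b ∙ v′)) +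
                   ((B + B) + a * a) * (K * quad schur v′ - c * (v′ ∙ v′)))
        slack₂ = ((B + B) + a * a) * K * (u * u) + (c + c) * quad schur v′
        0≤c+c : 0# ≤ c + c
        0≤c+c = +-nonneg (inj₁ 0<c) (inj₁ 0<c)
        0≤D : 0# ≤ (B + B) + a * a
        0≤D = +-nonneg (+-nonneg (∙-self-nonneg b) (∙-self-nonneg b)) (square-nonneg a)
        0≤q : 0# ≤ quad schur v′
        0≤q = *-cancelˡ-≤ 0<K (≤-resp (sym (zeroʳ K)) refl
          (≤-trans (*-nonneg (inj₁ 0<c) (∙-self-nonneg v′)) (bound v′)))

      e₀ : Vector Carrier (suc n)
      e₀ zero    = 1#
      e₀ (suc _) = 0#

      quad-e₀ : quad M e₀ ≈ a
      quad-e₀ = trans (quad-block e₀) (trans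
        (+-cong (+-congˡ (trans (+-cong β≈0 β≈0) (+-identityʳ 0#)))
                (sum-zero (λ i → zeroˡ ((C ⊛ (λ _ → 0#)) i))))
        (trans (+-identityʳ _) (trans (+-identityʳ _) (trans (*-congˡ (*-identityˡ 1#)) (*-identityʳ a)))))
        where
        β≈0 : 1# * (b ∙ (λ _ → 0#)) ≈ 0#
        β≈0 = trans (*-identityˡ _) (∙-zeroʳ b)

      e₀-singular : a ≈ 0# → (∀ i → b i ≈ 0#) → ∀ i → (M ⊛ e₀) i ≈ 0#
      e₀-singular a≈0 b≈0 zero    = trans (+-cong (trans (*-identityʳ a) a≈0) (∙-zeroʳ b)) (+-identityʳ 0#)
      e₀-singular a≈0 b≈0 (suc i) = trans (⊛-suc e₀ i)
        (trans (+-cong (trans (*-identityʳ (b i)) (b≈0 i)) (∙-zeroʳ (C i))) (+-identityʳ 0#))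

      -- For a vanishing corner the form at (x, tb) is 2xtB + t² quad C b with B = b ∙ b. The choice
      -- t = 2B makes this t²(x + quad C b), and the leading coordinate is then set to reach exactly
      -- -t².
      isotropic : Vector Carrier (suc n)
      isotropic zero    = - (quad C b + 1#)
      isotropic (suc i) = (b ∙ b + b ∙ b) * b i

      quad-isotropic : a ≈ 0# → NonZero b → quad M isotropic < 0#
      quad-isotropic a≈0 b≉0 = <-resp (sym eq) refl
        (<-by {d = t * t} (sym (-‿inverseˡ (t * t))) (*-pos 0<t 0<t))
        where
        B t : Carrier
        B = b ∙ b
        t = B + B
        0<t : 0# < t
        0<t = +-pos-nonneg (∙-self-pos b≉0) (∙-self-nonneg b)
        eq : quad M isotropic ≈ - (t * t)
        eq = begin
          quad M isotropic
            ≈⟨ quad-block isotropic ⟩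
          (a * (x * x) + (x * (b ∙ (λ i → t * b i)) + x * (b ∙ (λ i → t * b i)))) + quad C (λ i → t * b i)
            ≈⟨ +-cong (+-cong (trans (*-congʳ a≈0) (zeroˡ _)) (+-cong (*-congˡ (∙-scaleʳ t b b)) (*-congˡ (∙-scaleʳ t b b))))
                 (trans (∙-scaleˡ t b _) (*-congˡ (trans (∙-cong {u = b} (λ _ → refl) (λ i → ∙-scaleʳ t (C i) b)) (∙-scaleʳ t b (C ⊛ b))))) ⟩
          (0# + (x * (t * B) + x * (t * B))) + t * (t * quad C b)
            ≈⟨ +-congʳ (+-identityˡ _) ⟩
          (x * (t * B) + x * (t * B)) + t * (t * quad C b)
            ≈⟨ solve 3 (λ q B o → ((:- (q :+ o)) :* ((B :+ B) :* B) :+ (:- (q :+ o)) :* ((B :+ B) :* B)) :+ (B :+ B) :* ((B :+ B) :* q)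
                 := :- ((B :+ B) :* (B :+ B) :* o)) refl (quad C b) B 1# ⟩
          - (t * t * 1#)
            ≈⟨ -‿cong (*-identityʳ _) ⟩
          - (t * t) ∎
          where
          x : Carrier
          x = - (quad C b + 1#)

  abstract
    -- The sign of the pivot decides. A negative pivot is a negative value at `e₀`; for a zero
    -- pivot, a nonzero rest of the row makes the form negative somewhere, and a zero rest puts `e₀`
    -- into the kernel. Only a positive pivot needs the Schur complement.
    definiteness : ∀ {n} (M : Matrix n) → Symmetric M → Definiteness M
    definiteness {zero}  M M-sym = coercive 1# 1# 0<1 0<1 (λ _ → ≤-refl)
    definiteness {suc n} M M-sym with compare (M zero zero) 0#
    ... | tri< a<0 _ _ = negative e₀ (<-resp (sym quad-e₀) refl a<0)
      where open Block M M-sym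
    ... | tri≈ _ a≈0 _ = degenerate (nonZero? b)
      where
      open Block M M-sym
      degenerate : Dec (NonZero b) → Definiteness M
      degenerate (yes b≉0) = negative isotropic (quad-isotropic a≈0 b≉0)
      degenerate (no b≈0)  = singular e₀ (zero , λ 1≈0 → 0≉1 (sym 1≈0)) (e₀-singular a≈0 (¬nonZero⇒≈0 b≈0))
    ... | tri> _ _ 0<a = extend (definiteness schur schur-sym)
      where
      open Block M M-sym
      extend : Definiteness schur → Definiteness M
      extend (coercive c K 0<c 0<K bound) = coercive _ _
        (*-pos 0<c (*-pos 0<a 0<a))
        (+-pos-nonneg (*-pos (+-pos-nonneg 0<c (inj₁ 0<c)) 0<a)
          (*-nonneg (*-nonneg (+-nonneg (+-nonneg (∙-self-nonneg b) (∙-self-nonneg b)) (square-nonneg a)) (inj₁ 0<K)) (inj₁ 0<a)))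
        (coercive-lift c K 0<c 0<K bound)
      extend (negative v q<0)             = negative (lift v) (quad-lift 0<a v q<0)
      extend (singular v v≉0 Sv≈0)        = singular (lift v) (nonZero-lift 0<a v v≉0) (singular-lift 0<a v Sv≈0)

-- Matrix powers, trace bounds, switching invariance and existence of the spectral radius.

module SpectralRadius (ℝ : RealNumbers) where

  open RealNumbers ℝ hiding (zero)
  open OrderedField ℝ
  open LinearAlgebra ℝ
  open CommutativeMonoidSum +-commutativeMonoid using (∑-comm)
  open RingProperties ring using (-‿distribˡ-*)
  open SemiringSum semiring using (*-distribˡ-sum; *-distribʳ-sum)
  open SetoidReasoning setoid

  identity-⊛ : ∀ {n} (v : Vector Carrier n) i → (identity ⊛ v) i ≈ v i
  identity-⊛ v zero    = trans (+-cong (*-identityˡ _) (sum-zero (λ j → zeroˡ (v (suc j))))) (+-identityʳ _)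
  identity-⊛ v (suc i) = trans (+-cong (zeroˡ _) (identity-⊛ (v ∘ suc) i)) (+-identityˡ _)

  identity-sym : ∀ {n} → Symmetric (identity {n})
  identity-sym zero    zero    = refl
  identity-sym zero    (suc j) = refl
  identity-sym (suc i) zero    = refl
  identity-sym (suc i) (suc j) = identity-sym i j

  ⊗-⊛ : ∀ {n} (A B : Matrix n) v i → ((A ⊗ B) ⊛ v) i ≈ (A ⊛ B ⊛ v) i
  ⊗-⊛ A B v i = begin
    sum (λ j → sum (λ l → A i l * B l j) * v j)
      ≈⟨ sum-cong (λ j → trans (*-distribʳ-sum (v j) (λ l → A i l * B l j)) (sum-cong λ l → *-assoc (A i l) (B l j) (v j))) ⟩
    sum (λ j → sum (λ l → A i l * (B l j * v j)))   ≈⟨ ∑-comm (λ j l → A i l * (B l j * v j)) ⟩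
    sum (λ l → sum (λ j → A i l * (B l j * v j)))   ≈⟨ sum-cong (λ l → *-distribˡ-sum (A i l) (λ j → B l j * v j)) ⟨
    sum (λ l → A i l * sum (λ j → B l j * v j))     ∎

  ⊛-sym : ∀ {n} {A : Matrix n} → Symmetric A → ∀ u v → u ∙ A ⊛ v ≈ (A ⊛ u) ∙ v
  ⊛-sym {A = A} A-sym u v = begin
    sum (λ i → u i * sum (λ j → A i j * v j))     ≈⟨ sum-cong (λ i → *-distribˡ-sum (u i) (λ j → A i j * v j)) ⟩
    sum (λ i → sum (λ j → u i * (A i j * v j)))   ≈⟨ ∑-comm (λ i j → u i * (A i j * v j)) ⟩
    sum (λ j → sum (λ i → u i * (A i j * v j)))
      ≈⟨ sum-cong (λ j → sum-cong λ i → trans (*-congˡ (*-congʳ (A-sym i j))) (solve 3 (λ x y z → x :* (y :* z) := y :* x :* z) refl (u i) (A j i) (v j))) ⟩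
    sum (λ j → sum (λ i → A j i * u i * v j))     ≈⟨ sum-cong (λ j → *-distribʳ-sum (v j) (λ i → A j i * u i)) ⟨
    sum (λ j → sum (λ i → A j i * u i) * v j)     ∎

  ⊗-sym : ∀ {n} {A : Matrix n} → Symmetric A → Symmetric (A ⊗ A)
  ⊗-sym {A = A} A-sym i j = sum-cong (λ l → trans (*-comm (A i l) (A l j)) (*-cong (A-sym l j) (A-sym i l)))

  ⊛-eigen-power : ∀ {n} (A : Matrix n) {μ v} → (∀ i → (A ⊛ v) i ≈ μ * v i) →
                  ∀ k i → (power A k ⊛ v) i ≈ μ ^ k * v i
  ⊛-eigen-power A {v = v} Av≈μv zero i = trans (identity-⊛ v i) (sym (*-identityˡ (v i)))
  ⊛-eigen-power A {μ} {v} Av≈μv (suc k) i = begin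
    ((A ⊗ power A k) ⊛ v) i          ≈⟨ ⊗-⊛ A (power A k) v i ⟩
    A i ∙ (power A k ⊛ v)            ≈⟨ ∙-cong {u = A i} (λ _ → refl) (⊛-eigen-power A Av≈μv k) ⟩
    A i ∙ (λ j → μ ^ k * v j)        ≈⟨ ∙-scaleʳ (μ ^ k) (A i) v ⟩
    μ ^ k * (A ⊛ v) i                ≈⟨ *-congˡ (Av≈μv i) ⟩
    μ ^ k * (μ * v i)                ≈⟨ solve 3 (λ p μ x → p :* (μ :* x) := μ :* p :* x) refl (μ ^ k) μ (v i) ⟩
    μ * μ ^ k * v i                  ∎

  power-+ : ∀ {n} (A : Matrix n) a b i j → power A (a ℕ.+ b) i j ≈ (power A a ⊗ power A b) i j
  power-+ A zero    b i j = sym (identity-⊛ (λ l → power A b l j) i)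
  power-+ A (suc a) b i j = begin
    sum (λ l → A i l * power A (a ℕ.+ b) l j)          ≈⟨ sum-cong (λ l → *-congˡ (power-+ A a b l j)) ⟩
    (A ⊛ power A a ⊛ (λ l → power A b l j)) i          ≈⟨ ⊗-⊛ A (power A a) (λ l → power A b l j) i ⟨
    sum (λ l → (A ⊗ power A a) i l * power A b l j)    ∎

  power-1 : ∀ {n} (A : Matrix n) i j → power A 1 i j ≈ A i j
  power-1 A i j = trans (sum-cong (λ l → trans (*-congˡ (identity-sym l j)) (*-comm (A i l) (identity j l))))
    (identity-⊛ (λ l → A i l) j)

  -- Transposing A · Aᵏ gives Aᵏ · A, and both products are Aᵏ⁺¹ by additivity of exponents.
  power-sym : ∀ {n} {A : Matrix n} → Symmetric A → ∀ k → Symmetric (power A k)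
  power-sym A-sym zero i j = identity-sym i j
  power-sym {A = A} A-sym (suc k) i j = begin
    sum (λ l → A i l * power A k l j)
      ≈⟨ sum-cong (λ l → trans (*-comm (A i l) _) (*-cong (power-sym A-sym k l j) (trans (A-sym i l) (sym (power-1 A l i))))) ⟩
    (power A k ⊗ power A 1) j i                  ≈⟨ power-+ A k 1 j i ⟨
    power A (k ℕ.+ 1) j i                        ≡⟨ ≡.cong (λ m → power A m j i) (ℕ.+-comm k 1) ⟩
    power A (suc k) j i                          ∎

  -- The right side is the squared Frobenius norm of Aᵏ. This form makes the trace visibly
  -- nonnegative and lets Cauchy-Schwarz compare it with eigenvalues.
  trace-even-power : ∀ {n} {A : Matrix n} → Symmetric A → ∀ k →
                     trace (power A (2 ℕ.* k)) ≈ sum (λ i → power A k i ∙ power A k i)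
  trace-even-power {A = A} A-sym k = sum-cong λ i → begin
    power A (k ℕ.+ (k ℕ.+ 0)) i i           ≡⟨ ≡.cong (λ m → power A (k ℕ.+ m) i i) (ℕ.+-identityʳ k) ⟩
    power A (k ℕ.+ k) i i                   ≈⟨ power-+ A k k i i ⟩
    sum (λ l → power A k i l * power A k l i) ≈⟨ sum-cong (λ l → *-congˡ (power-sym A-sym k l i)) ⟩
    power A k i ∙ power A k i               ∎

  ⊛-bounded : ∀ {n} (A : Matrix n) v → (A ⊛ v) ∙ (A ⊛ v) ≤ sum (λ i → A i ∙ A i) * (v ∙ v)
  ⊛-bounded A v = ≤-resp refl (sym (*-distribʳ-sum (v ∙ v) (λ i → A i ∙ A i)))
    (sum-mono (λ i → cauchy-schwarz (A i) v))

  ∙-scale-self : ∀ {n} c {u : Vector Carrier n} {v} → (∀ i → u i ≈ c * v i) → u ∙ u ≈ c * c * (v ∙ v)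
  ∙-scale-self c {u} {v} u≈cv = trans (∙-cong u≈cv u≈cv)
    (trans (∙-scaleˡ c v (λ i → c * v i)) (trans (*-congˡ (∙-scaleʳ c v v)) (sym (*-assoc c c (v ∙ v)))))

  -- For an eigenvector v, μ²ᵏ|v|² = |Aᵏv|², and Cauchy-Schwarz in each row bounds this by the
  -- squared Frobenius norm of Aᵏ times |v|². Cancelling |v|² > 0 leaves the claim, with no other
  -- eigenvalue involved.
  eigenvalue-power≤trace : ∀ {n} {A : Matrix n} → Symmetric A → ∀ {μ} → IsEigenvalue A μ →
                           ∀ k → μ ^ k * μ ^ k ≤ trace (power A (2 ℕ.* k))
  eigenvalue-power≤trace {A = A} A-sym {μ} (v , v≉0 , Av≈μv) k =
    *-cancelˡ-≤ (∙-self-pos v≉0) (≤-resp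
      (trans (∙-scale-self (μ ^ k) {v = v} (⊛-eigen-power A Av≈μv k)) (*-comm _ _))
      (trans (*-comm _ _) (*-congˡ (sym (trace-even-power A-sym k))))
      (⊛-bounded (power A k) v))

  trace-even-power-nonneg : ∀ {n} {A : Matrix n} → Symmetric A → ∀ k → 0# ≤ trace (power A (2 ℕ.* k))
  trace-even-power-nonneg {A = A} A-sym k = ≤-resp refl (sym (trace-even-power A-sym k))
    (sum-nonneg (λ i → ∙-self-nonneg (power A k i)))

  ^-double : ∀ x k → x ^ (2 ℕ.* k) ≈ x ^ k * x ^ k
  ^-double x k = trans (reflexive (≡.cong (λ m → x ^ (k ℕ.+ m)) (ℕ.+-identityʳ k))) (Exp.^-homo-* semiring x k k)

  ∣∣-^-double : ∀ x k → ∣ x ∣ ^ (2 ℕ.* k) ≈ x ^ k * x ^ k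
  ∣∣-^-double x k = trans (^-double ∣ x ∣ k) (go k)
    where
    go : ∀ k → ∣ x ∣ ^ k * ∣ x ∣ ^ k ≈ x ^ k * x ^ k
    go zero    = refl
    go (suc k) = begin
      (∣ x ∣ * ∣ x ∣ ^ k) * (∣ x ∣ * ∣ x ∣ ^ k)
        ≈⟨ solve 2 (λ a b → (a :* b) :* (a :* b) := (a :* a) :* (b :* b)) refl _ _ ⟩
      (∣ x ∣ * ∣ x ∣) * (∣ x ∣ ^ k * ∣ x ∣ ^ k)   ≈⟨ *-cong (∣∣-square x) (go k) ⟩
      (x * x) * (x ^ k * x ^ k)
        ≈⟨ solve 2 (λ a b → (a :* b) :* (a :* b) := (a :* a) :* (b :* b)) refl _ _ ⟨
      (x * x ^ k) * (x * x ^ k)                   ∎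

  spectralRadius-power≤trace : ∀ {n} {A : Matrix n} → Symmetric A → ∀ {ρ} → IsSpectralRadius A ρ →
                               ∀ k → ρ ^ (2 ℕ.* k) ≤ trace (power A (2 ℕ.* k))
  spectralRadius-power≤trace A-sym ((μ , μ-eigen , ρ≈∣μ∣) , _) k =
    ≤-resp (sym (trans (Exp.^-congˡ semiring (2 ℕ.* k) ρ≈∣μ∣) (∣∣-^-double μ k))) refl
      (eigenvalue-power≤trace A-sym μ-eigen k)

  eigenvalue-conjugate : ∀ {n} {A B : Matrix n} (δ : Vector Carrier n) → (∀ i → δ i * δ i ≈ 1#) →
                         (∀ i j → B i j ≈ δ i * δ j * A i j) → ∀ {μ} → IsEigenvalue A μ → IsEigenvalue B μ
  eigenvalue-conjugate {A = A} {B} δ δ²≈1 B≈δAδ {μ} (v , (i₀ , v≉0) , Av≈μv) = w , (i₀ , w≉0) , Bw≈μw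
    where
    w : Vector Carrier _
    w i = δ i * v i
    δw≈v : ∀ i → δ i * w i ≈ v i
    δw≈v i = trans (sym (*-assoc _ _ _)) (trans (*-congʳ (δ²≈1 i)) (*-identityˡ (v i)))
    w≉0 : ¬ w i₀ ≈ 0#
    w≉0 w≈0 = v≉0 (trans (sym (δw≈v i₀)) (trans (*-congˡ w≈0) (zeroʳ _)))
    Bw≈μw : ∀ i → (B ⊛ w) i ≈ μ * w i
    Bw≈μw i = begin
      sum (λ j → B i j * w j)
        ≈⟨ sum-cong (λ j → trans (*-congʳ (B≈δAδ i j)) (solve 4 (λ x y a w → x :* y :* a :* w := x :* (a :* (y :* w))) refl (δ i) (δ j) (A i j) (w j))) ⟩
      sum (λ j → δ i * (A i j * (δ j * w j)))      ≈⟨ sum-cong (λ j → *-congˡ (*-congˡ (δw≈v j))) ⟩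
      sum (λ j → δ i * (A i j * v j))              ≈⟨ *-distribˡ-sum (δ i) (λ j → A i j * v j) ⟨
      δ i * (A ⊛ v) i                              ≈⟨ *-congˡ (Av≈μv i) ⟩
      δ i * (μ * v i)                              ≈⟨ solve 3 (λ d m x → d :* (m :* x) := m :* (d :* x)) refl _ _ _ ⟩
      μ * w i                                      ∎

  -- The supremum of the quotients |Av|²/|v|² and the eigenvector it yields.

  private
    module Existence {n} (A : Matrix n) (A-sym : Symmetric A) where

      F : Carrier
      F = sum (λ i → A i ∙ A i)

      Ratio : Carrier → Set
      Ratio t = ∃[ v ] (0# < v ∙ v) × t * (v ∙ v) ≈ (A ⊛ v) ∙ (A ⊛ v)

      ratio : ∀ v → 0# < v ∙ v → ∃ Ratio
      ratio v 0<vv = (A ⊛ v) ∙ (A ⊛ v) * (v ∙ v) ⁻¹ , v , 0<vv ,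
        trans (*-assoc _ _ _) (trans (*-congˡ (trans (*-comm _ _) (⁻¹-inverse _ (pos⇒≉0 0<vv)))) (*-identityʳ _))

      ratio≤F : IsUpperBound Ratio F
      ratio≤F t (v , 0<vv , t-ratio) = *-cancelˡ-≤ 0<vv
        (≤-resp (trans (sym t-ratio) (*-comm _ _)) (*-comm _ _) (⊛-bounded A v))

      ratio-nonneg : ∀ {t} → Ratio t → 0# ≤ t
      ratio-nonneg (v , 0<vv , t-ratio) = *-cancelˡ-≤ 0<vv
        (≤-resp (sym (zeroʳ _)) (trans (sym t-ratio) (*-comm _ _)) (∙-self-nonneg (A ⊛ v)))

      eigenvalue²-ratio : ∀ {μ} → IsEigenvalue A μ → Ratio (μ * μ)
      eigenvalue²-ratio {μ} (v , v≉0 , Av≈μv) = v , ∙-self-pos v≉0 , sym (∙-scale-self μ {v = v} Av≈μv)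

      module _ {t} (upper : IsUpperBound Ratio t) (least : ∀ b → IsUpperBound Ratio b → t ≤ b) where

        M : Matrix n
        M i j = t * identity i j + - (A ⊗ A) i j

        M-sym : Symmetric M
        M-sym i j = +-cong (*-congˡ (identity-sym i j)) (-‿cong (⊗-sym A-sym i j))

        M-⊛ : ∀ v i → (M ⊛ v) i ≈ t * v i + - 1# * (A ⊛ A ⊛ v) i
        M-⊛ v i = begin
          (M ⊛ v) i
            ≈⟨ ∙-distribʳ v (λ j → t * identity i j) (λ j → - (A ⊗ A) i j) ⟩
          (λ j → t * identity i j) ∙ v + (λ j → - (A ⊗ A) i j) ∙ v
            ≈⟨ +-cong (trans (∙-scaleˡ t (identity i) v) (*-congˡ (identity-⊛ v i)))
                 (trans (∙-cong {v = v} (λ j → sym (trans (sym (-‿distribˡ-* 1# _)) (-‿cong (*-identityˡ _)))) (λ _ → refl))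
                   (trans (∙-scaleˡ (- 1#) ((A ⊗ A) i) v) (*-congˡ (⊗-⊛ A A v i)))) ⟩
          t * v i + - 1# * (A ⊛ A ⊛ v) i ∎

        quad-M : ∀ v → quad M v ≈ t * (v ∙ v) - (A ⊛ v) ∙ (A ⊛ v)
        quad-M v = begin
          v ∙ M ⊛ v
            ≈⟨ ∙-cong {u = v} (λ _ → refl) (M-⊛ v) ⟩
          v ∙ (λ i → t * v i + - 1# * (A ⊛ A ⊛ v) i)
            ≈⟨ ∙-distribˡ v (λ i → t * v i) (λ i → - 1# * (A ⊛ A ⊛ v) i) ⟩
          v ∙ (λ i → t * v i) + v ∙ (λ i → - 1# * (A ⊛ A ⊛ v) i)
            ≈⟨ +-cong (∙-scaleʳ t v v) (trans (∙-scaleʳ (- 1#) v (A ⊛ A ⊛ v)) (trans (sym (-‿distribˡ-* 1# _)) (-‿cong (trans (*-identityˡ _) (⊛-sym A-sym v (A ⊛ v)))))) ⟩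
          t * (v ∙ v) - (A ⊛ v) ∙ (A ⊛ v) ∎

        -- A negative value at v says t|v|² < |Av|², so the quotient of v would exceed the upper
        -- bound t. The quotient exists because |v|² = 0 would force |Av|² = 0 as well, by the
        -- Frobenius bound.
        not-negative : ∀ v → ¬ quad M v < 0#
        not-negative v q<0 = ≤⇒≯ (upper s s-ratio) t<s
          where
          tvv<AvAv : t * (v ∙ v) < (A ⊛ v) ∙ (A ⊛ v)
          tvv<AvAv = <-by (solve 2 (λ x y → y := x :+ (:- (x :- y))) refl _ _)
            (neg-pos (<-resp (quad-M v) refl q<0))
          0<vv : 0# < v ∙ v
          0<vv with compare 0# (v ∙ v)
          ... | tri< 0<vv _ _ = 0<vv
          ... | tri> _ _ vv<0 = contradiction vv<0 (≤⇒≯ (∙-self-nonneg v))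
          ... | tri≈ _ 0≈vv _ = contradiction tvv<AvAv (≤⇒≯ (≤-trans (⊛-bounded A v)
                  (inj₂ (trans (*-congˡ (sym 0≈vv)) (trans (zeroʳ F) (sym (trans (*-congˡ (sym 0≈vv)) (zeroʳ t))))))))
          s : Carrier
          s = proj₁ (ratio v 0<vv)
          s-ratio : Ratio s
          s-ratio = proj₂ (ratio v 0<vv)
          t<s : t < s
          t<s = *-cancelˡ-< (inj₁ 0<vv) (<-resp (*-comm t (v ∙ v)) (trans (sym (proj₂ (proj₂ s-ratio))) (*-comm s (v ∙ v))) tvv<AvAv)

        not-coercive : ∀ c K → 0# < c → 0# < K → ¬ (∀ v → c * (v ∙ v) ≤ K * quad M v)
        not-coercive c K 0<c 0<K bound = ≤⇒≯ (least (t - ε) smaller) (<-by (solve 2 (λ t ε → t := (t :- ε) :+ ε) refl t ε) 0<ε)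
          where
          ε : Carrier
          -- Coercivity with constant c/K reads |Av|² ≤ (t - c/K)|v|², so t - ε would be a smaller
          -- upper bound.
          ε = c * K ⁻¹
          0<ε : 0# < ε
          0<ε = *-pos 0<c (inverse-pos 0<K)
          Kε≈c : K * ε ≈ c
          Kε≈c = trans (solve 3 (λ k c i → k :* (c :* i) := c :* (k :* i)) refl K c (K ⁻¹))
            (trans (*-congˡ (⁻¹-inverse K (pos⇒≉0 0<K))) (*-identityʳ c))
          smaller : IsUpperBound Ratio (t - ε)
          smaller s (v , 0<vv , s-ratio) = *-cancelˡ-≤ (*-pos 0<K 0<vv) (≤-by
            {d = K * (t * (v ∙ v) - s * (v ∙ v)) - K * ε * (v ∙ v)}
            (solve 5 (λ K N t ε s → K :* N :* (t :- ε) := K :* N :* s :+ (K :* (t :* N :- s :* N) :- K :* ε :* N)) refl K (v ∙ v) t ε s)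
            (sub-nonneg (≤-resp (*-congʳ (sym Kε≈c)) (*-congˡ (trans (quad-M v) (+-congˡ (-‿cong (sym s-ratio))))) (bound v))))

        -- The factorisation (A - ρ)(A + ρ)v = 0 leaves two cases: (A + ρ)v is nonzero and an
        -- eigenvector for ρ, or it vanishes and v is an eigenvector for -ρ.
        attained : ∀ {ρ} → 0# ≤ ρ → ρ * ρ ≈ t → ∀ v → NonZero v → (∀ i → (M ⊛ v) i ≈ 0#) →
                   ∃[ μ ] IsEigenvalue A μ × ρ ≈ ∣ μ ∣
        attained {ρ} 0≤ρ ρ²≈t v v≉0 Mv≈0 with nonZero? (λ i → (A ⊛ v) i + ρ * v i)
        ... | yes w≉0 = ρ , ((λ i → (A ⊛ v) i + ρ * v i) , w≉0 , Aw≈ρw) , sym (nonneg-∣∣ 0≤ρ)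
          where
          AAv≈ρρv : ∀ i → (A ⊛ A ⊛ v) i ≈ ρ * ρ * v i
          AAv≈ρρv i = begin
            (A ⊛ A ⊛ v) i
              ≈⟨ +-identityʳ _ ⟨
            (A ⊛ A ⊛ v) i + 0#
              ≈⟨ +-congˡ (trans (sym (M-⊛ v i)) (Mv≈0 i)) ⟨
            (A ⊛ A ⊛ v) i + (t * v i + - 1# * (A ⊛ A ⊛ v) i)
              ≈⟨ +-congˡ (+-congˡ (trans (sym (-‿distribˡ-* 1# _)) (-‿cong (*-identityˡ _)))) ⟩
            (A ⊛ A ⊛ v) i + (t * v i - (A ⊛ A ⊛ v) i)
              ≈⟨ solve 2 (λ x y → x :+ (y :- x) := y) refl _ _ ⟩
            t * v i
              ≈⟨ *-congʳ ρ²≈t ⟨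
            ρ * ρ * v i ∎
          Aw≈ρw : ∀ i → (A ⊛ (λ j → (A ⊛ v) j + ρ * v j)) i ≈ ρ * ((A ⊛ v) i + ρ * v i)
          Aw≈ρw i = begin
            A i ∙ (λ j → (A ⊛ v) j + ρ * v j)    ≈⟨ ∙-distribˡ (A i) (A ⊛ v) (λ j → ρ * v j) ⟩
            (A ⊛ A ⊛ v) i + A i ∙ (λ j → ρ * v j) ≈⟨ +-cong (AAv≈ρρv i) (∙-scaleʳ ρ (A i) v) ⟩
            ρ * ρ * v i + ρ * (A ⊛ v) i
              ≈⟨ solve 3 (λ r x y → r :* r :* x :+ r :* y := r :* (y :+ r :* x)) refl ρ (v i) ((A ⊛ v) i) ⟩
            ρ * ((A ⊛ v) i + ρ * v i)            ∎
        ... | no w≈0 = - ρ , (v , v≉0 , λ i → begin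
            (A ⊛ v) i
              ≈⟨ solve 3 (λ x r y → x := (x :+ r :* y) :+ (:- r) :* y) refl ((A ⊛ v) i) ρ (v i) ⟩
            ((A ⊛ v) i + ρ * v i) + - ρ * v i     ≈⟨ +-congʳ (¬nonZero⇒≈0 w≈0 i) ⟩
            0# + - ρ * v i                        ≈⟨ +-identityˡ _ ⟩
            - ρ * v i                             ∎) , sym (neg-∣∣ 0≤ρ)

        singularVector : ∃[ v ] NonZero v × (∀ i → (M ⊛ v) i ≈ 0#)
        singularVector with definiteness M M-sym
        ... | coercive c K 0<c 0<K bound = contradiction bound (not-coercive c K 0<c 0<K)
        ... | negative v q<0             = contradiction q<0 (not-negative v)
        ... | singular v v≉0 Mv≈0        = v , v≉0 , Mv≈0

        bounds : ∀ {ρ} → 0# ≤ ρ → ρ ^ 2 ≈ t → ∀ x → (∃[ μ ] IsEigenvalue A μ × x ≈ ∣ μ ∣) → x ≤ ρ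
        bounds 0≤ρ ρ²≈t x (μ , μ-eigen , x≈∣μ∣) = ≤-trans (inj₂ x≈∣μ∣)
          (^-cancel-≤ {n = 2} (s≤s z≤n) 0≤ρ
            (≤-resp (sym (trans (*-congˡ (*-identityʳ ∣ μ ∣)) (∣∣-square μ))) (sym ρ²≈t) (upper (μ * μ) (eigenvalue²-ratio μ-eigen))))

        isSpectralRadius : ∀ {ρ} → 0# ≤ ρ → ρ ^ 2 ≈ t → IsSpectralRadius A ρ
        isSpectralRadius {ρ} 0≤ρ ρ²≈t =
          attained 0≤ρ (trans (*-congˡ (sym (*-identityʳ ρ))) ρ²≈t)
            (proj₁ singularVector) (proj₁ (proj₂ singularVector)) (proj₂ (proj₂ singularVector)) ,
          bounds 0≤ρ ρ²≈t

  abstract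
    -- The index excludes order 0, where there is no eigenvalue; it makes the all-ones vector
    -- nonzero, so that the set of quotients is inhabited.
    spectralRadius : ∀ {n} → Fin n → (A : Matrix n) → Symmetric A → ∃ (IsSpectralRadius A)
    spectralRadius i₀ A A-sym = proj₁ ρ-root , isSpectralRadius (proj₁ (proj₂ sup)) (proj₂ (proj₂ sup)) (proj₁ (proj₂ ρ-root)) (proj₂ (proj₂ ρ-root))
      where
      open Existence A A-sym
      nonempty : ∃ Ratio
      nonempty = ratio (λ _ → 1#) (∙-self-pos {v = λ _ → 1#} (i₀ , λ 1≈0 → 0≉1 (sym 1≈0)))
      sup : ∃[ s ] IsUpperBound Ratio s × (∀ b → IsUpperBound Ratio b → s ≤ b)
      sup = supremum Ratio nonempty (F , ratio≤F)
      ρ-root : ∃ (IsRoot 2 (proj₁ sup))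
      ρ-root = root {2} (s≤s z≤n)
        (≤-trans (ratio-nonneg (proj₂ nonempty)) (proj₁ (proj₂ sup) (proj₁ nonempty) (proj₂ nonempty)))

-- Filtering of mapped and concatenated lists.

module ListLemmas where

  open ≡ using (refl; trans; cong)

  filter-map : ∀ {A B : Set} {P : Pred B 0ℓ} (P? : Decidable P) (f : A → B) xs →
               filter P? (map f xs) ≡ map f (filter (P? ∘ f) xs)
  filter-map P? f []       = refl
  filter-map P? f (x ∷ xs) with does (P? (f x))
  ... | true  = cong (f x ∷_) (filter-map P? f xs)
  ... | false = filter-map P? f xs

  filter-concatMap : ∀ {A B : Set} {P : Pred B 0ℓ} (P? : Decidable P) (f : A → List B) xs →
                     filter P? (concatMap f xs) ≡ concatMap (filter P? ∘ f) xs
  filter-concatMap P? f []       = refl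
  filter-concatMap P? f (x ∷ xs) =
    trans (List.filter-++ P? (f x) (concatMap f xs)) (cong (filter P? (f x) ++_) (filter-concatMap P? f xs))

-- Parity vectors of walks, and edges as coordinates.

module WalkParities (G : SimpleGraph) where

  open SimpleGraph G
  open ListLemmas
  open BinaryVectors
  open ≡ using (refl; sym; trans; cong; cong₂; subst)
  open ≡-Reasoning
  open Walks (Fin._≟_ {order}) (neighbours G)

  edgeVector : Fin order × Fin order → 𝔽₂^ size
  edgeVector uv = Vec.tabulate (λ e → if does (joins? G e uv) then 1ℙ else 0ℙ)

  tabulate-+ : ∀ {m} (f g : Fin m → Parity) → Vec.tabulate (λ i → f i ℙ.+ g i) ≡ Vec.tabulate f ⊕ Vec.tabulate g
  tabulate-+ {zero}  f g = refl
  tabulate-+ {suc m} f g = cong ((f zero ℙ.+ g zero) ∷_) (tabulate-+ (f ∘ suc) (g ∘ suc))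

  tabulate-0 : ∀ m → Vec.tabulate {n = m} (λ _ → 0ℙ) ≡ 𝟘
  tabulate-0 zero    = refl
  tabulate-0 (suc m) = cong (0ℙ ∷_) (tabulate-0 m)

  parity-suc : ∀ n → parity (suc n) ≡ 1ℙ ℙ.+ parity n
  parity-suc zero          = refl
  parity-suc (suc zero)    = refl
  parity-suc (suc (suc n)) = parity-suc n

  parityVector-∷ : ∀ {ℓ} u v (w : Vec (Fin order) ℓ) →
                   parityVector G (u ∷ v ∷ w) ≡ edgeVector (u , v) ⊕ parityVector G (v ∷ w)
  parityVector-∷ u v w = trans (Vec.tabulate-cong step) (tabulate-+ _ _)
    where
    step : ∀ e → parity (Vec.count (joins? G e) (steps (u ∷ v ∷ w))) ≡
                 (if does (joins? G e (u , v)) then 1ℙ else 0ℙ) ℙ.+ parity (Vec.count (joins? G e) (steps (v ∷ w)))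
    step e with does (joins? G e (u , v))
    ... | true  = parity-suc (Vec.count (joins? G e) (steps (v ∷ w)))
    ... | false = refl

  head-walksFrom : ∀ ℓ u → All (λ w → Vec.head w ≡ u) (walksFrom ℓ u)
  head-walksFrom zero    u = refl ∷ []
  head-walksFrom (suc ℓ) u = All.concat⁺ {xss = map (λ j → map (u ∷_) (walksFrom ℓ j)) (neighbours G u)}
    (All.map⁺ {f = λ j → map (u ∷_) (walksFrom ℓ j)}
      (All.universal (λ j → All.map⁺ {f = u ∷_} (All.universal (λ _ → refl) (walksFrom ℓ j))) (neighbours G u)))

  -- Forgets the vertices of a walk and keeps its parity vector, with multiplicity. The recursion
  -- over the first step is that of `power`, so matrix entries can be compared by the same
  -- induction.
  parities : ℕ → Fin order → Fin order → List (𝔽₂^ size)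
  parities zero    u v = if does (u Fin.≟ v) then 𝟘 ∷ [] else []
  parities (suc ℓ) u v = concatMap (λ j → map (edgeVector (u , j) ⊕_) (parities ℓ j v)) (neighbours G u)

  parities-walksFrom : ∀ ℓ u v →
    map (parityVector G) (filter (λ w → Vec.last w Fin.≟ v) (walksFrom ℓ u)) ≡ parities ℓ u v
  parities-walksFrom zero u v with does (u Fin.≟ v)
  ... | true  = cong (_∷ []) (tabulate-0 size)
  ... | false = refl
  parities-walksFrom (suc ℓ) u v = begin
    map (parityVector G) (filter P? (concatMap (λ j → map (u ∷_) (walksFrom ℓ j)) (neighbours G u)))
      ≡⟨ cong (map (parityVector G)) (filter-concatMap P? (λ j → map (u ∷_) (walksFrom ℓ j)) (neighbours G u)) ⟩
    map (parityVector G) (concatMap (λ j → filter P? (map (u ∷_) (walksFrom ℓ j))) (neighbours G u))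
      ≡⟨ List.map-concatMap (parityVector G) (λ j → filter P? (map (u ∷_) (walksFrom ℓ j))) (neighbours G u) ⟩
    concatMap (λ j → map (parityVector G) (filter P? (map (u ∷_) (walksFrom ℓ j)))) (neighbours G u)
      ≡⟨ List.concatMap-cong first-step (neighbours G u) ⟩
    concatMap (λ j → map (edgeVector (u , j) ⊕_) (parities ℓ j v)) (neighbours G u) ∎
    where
    P? : Decidable (λ (w : Vec (Fin order) (suc (suc ℓ))) → Vec.last w ≡ v)
    P? w = Vec.last w Fin.≟ v
    prepend : ∀ j (w : Vec (Fin order) (suc ℓ)) → Vec.head w ≡ j →
              parityVector G (u ∷ w) ≡ edgeVector (u , j) ⊕ parityVector G w
    prepend j (j ∷ w) refl = parityVector-∷ u j w
    first-step : ∀ j → map (parityVector G) (filter P? (map (u ∷_) (walksFrom ℓ j))) ≡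
                       map (edgeVector (u , j) ⊕_) (parities ℓ j v)
    first-step j = begin
      map (parityVector G) (filter P? (map (u ∷_) (walksFrom ℓ j)))
        ≡⟨ cong (map (parityVector G)) (filter-map P? (u ∷_) (walksFrom ℓ j)) ⟩
      map (parityVector G) (map (u ∷_) ws)
        ≡⟨ List.map-∘ ws ⟨
      map (λ w → parityVector G (u ∷ w)) ws
        ≡⟨ List.map-cong-local (All.map (λ {w} → prepend j w) (All.filter⁺ _ (head-walksFrom ℓ j))) ⟩
      map (λ w → edgeVector (u , j) ⊕ parityVector G w) ws
        ≡⟨ List.map-∘ ws ⟩
      map (edgeVector (u , j) ⊕_) (map (parityVector G) ws)
        ≡⟨ cong (map (edgeVector (u , j) ⊕_)) (parities-walksFrom ℓ j v) ⟩
      map (edgeVector (u , j) ⊕_) (parities ℓ j v) ∎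
      where
      ws : List (Vec (Fin order) (suc ℓ))
      ws = filter (λ w → Vec.last w Fin.≟ v) (walksFrom ℓ j)

  closedParities : ℕ → List (𝔽₂^ size)
  closedParities ℓ = concatMap (λ v → parities ℓ v v) (allFin order)

  closedWalkCount≡ : ∀ ℓ z → closedWalkCount G ℓ z ≡ length (filter (_≟ᵛ z) (closedParities ℓ))
  closedWalkCount≡ ℓ z = begin
    length (filter (λ w → parityVector G w ≟ᵛ z) (closedWalks G ℓ))
      ≡⟨ List.length-map (parityVector G) (filter (λ w → parityVector G w ≟ᵛ z) (closedWalks G ℓ)) ⟨
    length (map (parityVector G) (filter (λ w → parityVector G w ≟ᵛ z) (closedWalks G ℓ)))
      ≡⟨ cong length (filter-map (_≟ᵛ z) (parityVector G) (closedWalks G ℓ)) ⟨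
    length (filter (_≟ᵛ z) (map (parityVector G) (closedWalks G ℓ)))
      ≡⟨ cong (length ∘ filter (_≟ᵛ z)) (trans (List.map-concatMap (parityVector G) (closedWalksAt ℓ) (allFin order))
           (List.concatMap-cong (λ v → parities-walksFrom ℓ v v) (allFin order))) ⟩
    length (filter (_≟ᵛ z) (closedParities ℓ)) ∎

  -- Equal orientations are settled by injectivity of `ends`; opposite ones would give both u < v
  -- and v < u.
  joins-unique : ∀ {e e′ u v} → Joins G e (u , v) → Joins G e′ (u , v) → e ≡ e′
  joins-unique (inj₁ p) (inj₁ q) = distinct (trans p (sym q))
  joins-unique (inj₂ p) (inj₂ q) = distinct (trans p (sym q))
  joins-unique {e} {e′} (inj₁ p) (inj₂ q) = contradiction
    (subst (λ x → proj₁ x Fin.< proj₂ x) q (ordered e′)) (Fin.<-asym (subst (λ x → proj₁ x Fin.< proj₂ x) p (ordered e)))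
  joins-unique {e} {e′} (inj₂ p) (inj₁ q) = contradiction
    (subst (λ x → proj₁ x Fin.< proj₂ x) q (ordered e′)) (Fin.<-asym (subst (λ x → proj₁ x Fin.< proj₂ x) p (ordered e)))

  dot-unit : ∀ {m} (s : 𝔽₂^ m) (f : Fin m → Parity) i → f i ≡ 1ℙ → (∀ j → j ≢ i → f j ≡ 0ℙ) →
             dot s (Vec.tabulate f) ≡ Vec.lookup s i
  dot-unit (p ∷ s) f zero fi fj = begin
    p ℙ.* f zero ℙ.+ dot s (Vec.tabulate (f ∘ suc))
      ≡⟨ cong₂ ℙ._+_ (trans (cong (p ℙ.*_) fi) (ℙ.*-identityʳ p)) (cong (dot s) (trans (Vec.tabulate-cong (λ j → fj (suc j) λ ())) (tabulate-0 _))) ⟩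
    p ℙ.+ dot s 𝟘                                     ≡⟨ cong (p ℙ.+_) (dot-𝟘ʳ s) ⟩
    p ℙ.+ 0ℙ                                          ≡⟨ ℙ.+-identityʳ p ⟩
    p                                                 ∎
  dot-unit (p ∷ s) f (suc i) fi fj = cong₂ ℙ._+_ (trans (cong (p ℙ.*_) (fj zero λ ())) (ℙ.*-zeroʳ p))
    (dot-unit s (f ∘ suc) i fi (λ j j≢i → fj (suc j) (j≢i ∘ Fin.suc-injective)))

  dot-edgeVector : ∀ s {e u v} → Joins G e (u , v) → dot s (edgeVector (u , v)) ≡ Vec.lookup s e
  dot-edgeVector s {e} {u} {v} e-joins = dot-unit s _ e
    (cong (if_then 1ℙ else 0ℙ) (dec-true (joins? G e (u , v)) e-joins))
    (λ e′ e′≢e → cong (if_then 1ℙ else 0ℙ) (dec-false (joins? G e′ (u , v)) (λ j → e′≢e (joins-unique j e-joins))))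

  isAt : Fin order → Fin order → Parity
  isAt x u = if does (u Fin.≟ x) then 1ℙ else 0ℙ

  -- The endpoints of an edge differ, so at most one of them is x and the disjunction in `incidence`
  -- is a sum modulo 2.
  lookup-incidence : ∀ x {e u v} → Joins G e (u , v) → Vec.lookup (incidence G x) e ≡ isAt x u ℙ.+ isAt x v
  lookup-incidence x {e} {u} {v} e-joins = trans (Vec.lookup∘tabulate _ e)
    (trans (endpoints (λ p≡q → Fin.<-irrefl p≡q (ordered e))) (orient e-joins))
    where
    endpoints : ∀ {p q} → p ≢ q →
      (if does (p Fin.≟ x) ∨ does (q Fin.≟ x) then 1ℙ else 0ℙ) ≡ isAt x p ℙ.+ isAt x q
    endpoints {p} {q} p≢q with p Fin.≟ x | q Fin.≟ x
    ... | yes refl | yes refl = contradiction refl p≢q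
    ... | yes _    | no _     = refl
    ... | no _     | yes _    = refl
    ... | no _     | no _     = refl
    orient : Joins G e (u , v) → isAt x (proj₁ (ends e)) ℙ.+ isAt x (proj₂ (ends e)) ≡ isAt x u ℙ.+ isAt x v
    orient (inj₁ eq) = cong (λ pq → isAt x (proj₁ pq) ℙ.+ isAt x (proj₂ pq)) eq
    orient (inj₂ eq) = trans (cong (λ pq → isAt x (proj₁ pq) ℙ.+ isAt x (proj₂ pq)) eq) (ℙ.+-comm (isAt x v) (isAt x u))

-- Signed adjacency matrices: symmetry, switching, and powers as sums over walks.

module SignedWalks (ℝ : RealNumbers) (G : SimpleGraph) where

  open RealNumbers ℝ hiding (zero)
  open SimpleGraph G
  open SignedGraphs ℝ G
  open OrderedField ℝ
  open LinearAlgebra ℝ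
  open SpectralRadius ℝ
  open ListSums ℝ
  open CharacterSums ℝ G
  open BinaryVectors
  open WalkParities G
  open SetoidReasoning setoid

  signedAdjacency-edge : ∀ s {e u v} → Joins G e (u , v) → signedAdjacency s u v ≡ sign (Vec.lookup s e)
  signedAdjacency-edge s {e} {u} {v} e-joins with adjacent? G u v
  ... | yes (e′ , e′-joins) = ≡.cong (sign ∘ Vec.lookup s) (joins-unique e′-joins e-joins)
  ... | no ¬adj             = contradiction (e , e-joins) ¬adj

  signedAdjacency-nonedge : ∀ s {u v} → ¬ Adjacent G u v → signedAdjacency s u v ≡ 0#
  signedAdjacency-nonedge s {u} {v} ¬adj with adjacent? G u v
  ... | yes adj = contradiction adj ¬adj
  ... | no _    = ≡.refl

  signedAdjacency-sym : ∀ s → Symmetric (signedAdjacency s)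
  signedAdjacency-sym s u v = by-cases (adjacent? G u v)
    where
    by-cases : Dec (Adjacent G u v) → signedAdjacency s u v ≈ signedAdjacency s v u
    by-cases (yes (e , e-joins)) = reflexive (≡.trans (signedAdjacency-edge s e-joins) (≡.sym (signedAdjacency-edge s (swap e-joins))))
    by-cases (no ¬adj) = reflexive (≡.trans (signedAdjacency-nonedge s ¬adj)
      (≡.sym (signedAdjacency-nonedge s (λ (e , e-joins) → ¬adj (e , swap e-joins)))))

  -- Switching at x is conjugation by the diagonal matrix with -1 at x and 1 elsewhere, hence
  -- preserves eigenvalues.
  signedAdjacency-switch : ∀ s x u v →
    signedAdjacency (s ⊕ incidence G x) u v ≈ sign (isAt x u) * sign (isAt x v) * signedAdjacency s u v
  signedAdjacency-switch s x u v = by-cases (adjacent? G u v)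
    where
    by-cases : Dec (Adjacent G u v) → signedAdjacency (s ⊕ incidence G x) u v ≈ sign (isAt x u) * sign (isAt x v) * signedAdjacency s u v
    by-cases (no ¬adj) = trans (reflexive (signedAdjacency-nonedge (s ⊕ incidence G x) ¬adj))
      (sym (trans (*-congˡ (reflexive (signedAdjacency-nonedge s ¬adj))) (zeroʳ _)))
    by-cases (yes (e , e-joins)) = begin
      signedAdjacency (s ⊕ incidence G x) u v
        ≡⟨ signedAdjacency-edge (s ⊕ incidence G x) e-joins ⟩
      sign (Vec.lookup (s ⊕ incidence G x) e)
        ≡⟨ ≡.cong sign (≡.trans (Vec.lookup-zipWith ℙ._+_ e s (incidence G x)) (≡.cong (Vec.lookup s e ℙ.+_) (lookup-incidence x e-joins))) ⟩
      sign (Vec.lookup s e ℙ.+ (isAt x u ℙ.+ isAt x v))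
        ≈⟨ trans (sign-+ (Vec.lookup s e) _) (*-comm _ _) ⟩
      sign (isAt x u ℙ.+ isAt x v) * sign (Vec.lookup s e)
        ≈⟨ *-cong (sign-+ (isAt x u) (isAt x v)) (reflexive (≡.sym (signedAdjacency-edge s e-joins))) ⟩
      sign (isAt x u) * sign (isAt x v) * signedAdjacency s u v ∎

  sign-square : ∀ p → sign p * sign p ≈ 1#
  sign-square p = trans (sym (sign-+ p p)) (reflexive (≡.cong sign (ℙ.p+p≡0ℙ p)))

  eigenvalue-switch : ∀ {s t} → SwitchedAtVertex G s t → ∀ {μ} →
                      IsEigenvalue (signedAdjacency s) μ → IsEigenvalue (signedAdjacency t) μ
  eigenvalue-switch {s} (x , ≡.refl) = eigenvalue-conjugate (sign ∘ isAt x) (sign-square ∘ isAt x) (signedAdjacency-switch s x)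

  sum-tabulate : ∀ {n} {A : Set} (g : Fin n → A) (f : A → Carrier) → sumOver (List.tabulate g) f ≡ sum (f ∘ g)
  sum-tabulate {zero}  g f = ≡.refl
  sum-tabulate {suc n} g f = ≡.cong (f (g zero) +_) (sum-tabulate (g ∘ suc) f)

  sum-neighbours : ∀ s u (f : Fin order → Carrier) →
    sum (λ j → signedAdjacency s u j * f j) ≈ ∑[ j ∈ neighbours G u ] (sign (dot s (edgeVector (u , j))) * f j)
  sum-neighbours s u f = begin
    sum (λ j → signedAdjacency s u j * f j)
      ≡⟨ sum-tabulate id (λ j → signedAdjacency s u j * f j) ⟨
    ∑[ j ∈ allFin order ] (signedAdjacency s u j * f j)
      ≈⟨ sumOver-cong (allFin order) term ⟩
    ∑[ j ∈ allFin order ] (if does (adjacent? G u j) then sign (dot s (edgeVector (u , j))) * f j else 0#)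
      ≈⟨ sumOver-filter (adjacent? G u) (allFin order) (λ j → sign (dot s (edgeVector (u , j))) * f j) ⟨
    ∑[ j ∈ neighbours G u ] (sign (dot s (edgeVector (u , j))) * f j) ∎
    where
    term : ∀ j → signedAdjacency s u j * f j ≈ (if does (adjacent? G u j) then sign (dot s (edgeVector (u , j))) * f j else 0#)
    term j with adjacent? G u j
    ... | yes (e , e-joins) = *-congʳ (reflexive (≡.cong sign (≡.sym (dot-edgeVector s e-joins))))
    ... | no _              = zeroˡ (f j)

  -- The sign of a walk is the product of the signs of its steps, and the character z ↦ (-1)^{s·z}
  -- turns the sum of edge vectors into exactly this product.
  power-entry : ∀ s ℓ u v → power (signedAdjacency s) ℓ u v ≈ ∑[ z ∈ parities ℓ u v ] sign (dot s z)
  power-entry s zero u v with does (u Fin.≟ v)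
  ... | true  = sym (trans (+-identityʳ _) (reflexive (≡.cong sign (dot-𝟘ʳ s))))
  ... | false = refl
  power-entry s (suc ℓ) u v = begin
    sum (λ j → signedAdjacency s u j * power (signedAdjacency s) ℓ j v)
      ≈⟨ sum-neighbours s u (λ j → power (signedAdjacency s) ℓ j v) ⟩
    ∑[ j ∈ neighbours G u ] (sign (dot s (edgeVector (u , j))) * power (signedAdjacency s) ℓ j v)
      ≈⟨ sumOver-cong (neighbours G u) first-step ⟩
    ∑[ j ∈ neighbours G u ] (∑[ z ∈ map (edgeVector (u , j) ⊕_) (parities ℓ j v) ] sign (dot s z))
      ≈⟨ sumOver-concatMap (λ j → map (edgeVector (u , j) ⊕_) (parities ℓ j v)) (neighbours G u) (sign ∘ dot s) ⟨
    ∑[ z ∈ parities (suc ℓ) u v ] sign (dot s z) ∎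
    where
    first-step : ∀ j → sign (dot s (edgeVector (u , j))) * power (signedAdjacency s) ℓ j v ≈
                       ∑[ z ∈ map (edgeVector (u , j) ⊕_) (parities ℓ j v) ] sign (dot s z)
    first-step j = begin
      sign (dot s (edgeVector (u , j))) * power (signedAdjacency s) ℓ j v
        ≈⟨ *-congˡ (power-entry s ℓ j v) ⟩
      sign (dot s (edgeVector (u , j))) * ∑[ z ∈ parities ℓ j v ] sign (dot s z)
        ≈⟨ sumOver-*ˡ (parities ℓ j v) _ (sign ∘ dot s) ⟨
      ∑[ z ∈ parities ℓ j v ] (sign (dot s (edgeVector (u , j))) * sign (dot s z))
        ≈⟨ sumOver-cong (parities ℓ j v) (λ z → trans (sym (sign-+ (dot s (edgeVector (u , j))) (dot s z)))
             (reflexive (≡.cong sign (≡.sym (dot-⊕ʳ s (edgeVector (u , j)) z))))) ⟩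
      ∑[ z ∈ parities ℓ j v ] sign (dot s (edgeVector (u , j) ⊕ z))
        ≡⟨ sumOver-map (edgeVector (u , j) ⊕_) (parities ℓ j v) (sign ∘ dot s) ⟨
      ∑[ z ∈ map (edgeVector (u , j) ⊕_) (parities ℓ j v) ] sign (dot s z) ∎

  trace-power : ∀ s ℓ → trace (power (signedAdjacency s) ℓ) ≈ ∑[ z ∈ closedParities ℓ ] sign (dot s z)
  trace-power s ℓ = begin
    sum (λ v → power (signedAdjacency s) ℓ v v)
      ≡⟨ sum-tabulate id (λ v → power (signedAdjacency s) ℓ v v) ⟨
    ∑[ v ∈ allFin order ] power (signedAdjacency s) ℓ v v
      ≈⟨ sumOver-cong (allFin order) (λ v → power-entry s ℓ v v) ⟩
    ∑[ v ∈ allFin order ] (∑[ z ∈ parities ℓ v v ] sign (dot s z))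
      ≈⟨ sumOver-concatMap (λ v → parities ℓ v v) (allFin order) (sign ∘ dot s) ⟨
    ∑[ z ∈ closedParities ℓ ] sign (dot s z) ∎

-- Lower bounds for sums of natural numbers over lists.

module ListCounting where

  open ≡ using (refl; sym; trans; cong; cong₂)

  length-concatMap : ∀ {A B : Set} (f : A → List B) xs → length (concatMap f xs) ≡ ListAction.sum (map (length ∘ f) xs)
  length-concatMap f []       = refl
  length-concatMap f (x ∷ xs) = trans (List.length-++ (f x)) (cong (length (f x) ℕ.+_) (length-concatMap f xs))

  sum-map-const : ∀ {A : Set} {f : A → ℕ} {c xs} → All (λ x → f x ≡ c) xs → ListAction.sum (map f xs) ≡ length xs ℕ.* c
  sum-map-const []           = refl
  sum-map-const (fx≡c ∷ rest) = cong₂ ℕ._+_ fx≡c (sum-map-const rest)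

  sum-map-≥ : ∀ {A : Set} (f : A → ℕ) {c} xs → (∀ {x} → x ∈ xs → c ℕ.≤ f x) →
              length xs ℕ.* c ℕ.≤ ListAction.sum (map f xs)
  sum-map-≥ f []       c≤f = z≤n
  sum-map-≥ f (x ∷ xs) c≤f = ℕ.+-mono-≤ (c≤f (here refl)) (sum-map-≥ f xs (c≤f ∘ there))

  -- Shaped after the tree recursion: one neighbour leads back towards the root, and each of the
  -- remaining ones leads away.
  sum-map-≥-special : ∀ {A : Set} (f : A → ℕ) {b c y xs} → y ∈ xs → b ℕ.≤ f y → (∀ {x} → x ∈ xs → c ℕ.≤ f x) →
                      b ℕ.+ (length xs ℕ.∸ 1) ℕ.* c ℕ.≤ ListAction.sum (map f xs)
  sum-map-≥-special f {xs = x ∷ xs} (here refl) b≤fy c≤f = ℕ.+-mono-≤ b≤fy (sum-map-≥ f xs (c≤f ∘ there))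
  sum-map-≥-special f {b} {c} {xs = x ∷ xs@(_ ∷ _)} (there y∈xs) b≤fy c≤f = begin
    b ℕ.+ (c ℕ.+ k)             ≡⟨ ℕ.+-assoc b c k ⟨
    b ℕ.+ c ℕ.+ k               ≡⟨ cong (ℕ._+ k) (ℕ.+-comm b c) ⟩
    c ℕ.+ b ℕ.+ k               ≡⟨ ℕ.+-assoc c b k ⟩
    c ℕ.+ (b ℕ.+ k)             ≤⟨ ℕ.+-mono-≤ (c≤f (here refl)) (sum-map-≥-special f y∈xs b≤fy (c≤f ∘ there)) ⟩
    f x ℕ.+ ListAction.sum (map f xs)      ∎
    where
    open ℕ.≤-Reasoning
    k : ℕ
    k = (length xs ℕ.∸ 1) ℕ.* c

  length-filter-≢ : ∀ {A : Set} (_≟_ : DecidableEquality A) {a xs} → Unique xs → a ∈ xs →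
                    length (filter (λ b → ¬? (b ≟ a)) xs) ≡ length xs ℕ.∸ 1
  length-filter-≢ _≟_ {a} {x ∷ xs} (x∉xs ∷ xs!) a∈ with x ≟ a | a∈
  ... | yes refl | _          = cong length (List.filter-all (λ b → ¬? (b ≟ a)) (All.map (λ x≢b b≡x → x≢b (sym b≡x)) x∉xs))
  ... | no x≢a   | here a≡x   = contradiction (sym a≡x) x≢a
  ... | no x≢a   | there a∈xs = trans (cong suc (length-filter-≢ _≟_ xs! a∈xs)) (suc-pred a∈xs)
    where
    suc-pred : ∀ {xs} → a ∈ xs → suc (length xs ℕ.∸ 1) ≡ length xs
    suc-pred (here _)  = refl
    suc-pred (there _) = refl

-- Comparison of closed walks in the regular tree and in the graph.

module TreeWalks where

  open ≡ using (refl; sym; trans; cong; cong₂; subst; subst₂)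
  open ListLemmas
  open ListCounting

  -- The number of walks of length ℓ in the d-regular tree from a fixed
  -- vertex at distance h from the root to the root.
  returns : (d ℓ h : ℕ) → ℕ
  returns d zero    zero    = 1
  returns d zero    (suc h) = 0
  returns d (suc ℓ) zero    = d ℕ.* returns d ℓ 1
  returns d (suc ℓ) (suc h) = returns d ℓ h ℕ.+ (d ℕ.∸ 1) ℕ.* returns d ℓ (2 ℕ.+ h)

  module _ (d : ℕ) where

    open Walks (List.≡-dec (Fin._≟_ {d})) (treeNeighbours d)

    returnsFrom : ℕ → List (Fin d) → ℕ
    returnsFrom ℓ w = length (filter (λ p → List.≡-dec Fin._≟_ (Vec.last p) []) (walksFrom ℓ w))

    returnsFrom-suc : ∀ ℓ w → returnsFrom (suc ℓ) w ≡ ListAction.sum (map (returnsFrom ℓ) (treeNeighbours d w))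
    returnsFrom-suc ℓ w = trans (cong length (filter-concatMap ends-at-root? first-step (treeNeighbours d w)))
      (trans (length-concatMap (filter ends-at-root? ∘ first-step) (treeNeighbours d w))
        (cong ListAction.sum (List.map-cong
          (λ u → trans (cong length (filter-map ends-at-root? (w ∷_) (walksFrom ℓ u)))
            (List.length-map (w ∷_) (filter (ends-at-root? ∘ (w ∷_)) (walksFrom ℓ u))))
          (treeNeighbours d w))))
      where
      first-step : List (Fin d) → List (Vec (List (Fin d)) (suc (suc ℓ)))
      first-step u = map (w ∷_) (walksFrom ℓ u)
      ends-at-root? : Decidable (λ (p : Vec (List (Fin d)) (suc (suc ℓ))) → Vec.last p ≡ [])
      ends-at-root? p = List.≡-dec Fin._≟_ (Vec.last p) []

    -- Every nonempty word has one shorter neighbour and d - 1 longer ones, whatever its labels, so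
    -- the count depends on the length alone.
    returnsFrom≡returns : ∀ ℓ w → returnsFrom ℓ w ≡ returns d ℓ (length w)
    returnsFrom≡returns zero []      = refl
    returnsFrom≡returns zero (a ∷ w) = refl
    returnsFrom≡returns (suc ℓ) [] = trans (returnsFrom-suc ℓ [])
      (trans (sum-map-const (All.map⁺ {f = _∷ []} (All.universal (λ a → returnsFrom≡returns ℓ (a ∷ [])) (allFin d))))
        (cong (ℕ._* returns d ℓ 1) (trans (List.length-map (_∷ []) (allFin d)) (List.length-tabulate {n = d} id))))
    returnsFrom≡returns (suc ℓ) (a ∷ w) = trans (returnsFrom-suc ℓ (a ∷ w))
      (cong₂ ℕ._+_ (returnsFrom≡returns ℓ w)
        (trans (sum-map-const (All.map⁺ {f = λ b → b ∷ a ∷ w} (All.universal (λ b → returnsFrom≡returns ℓ (b ∷ a ∷ w)) others)))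
          (cong (ℕ._* returns d ℓ (2 ℕ.+ length w)) (trans (List.length-map (λ b → b ∷ a ∷ w) others)
            (trans (length-filter-≢ Fin._≟_ (allFin⁺ d) (∈-allFin a)) (cong (ℕ._∸ 1) (List.length-tabulate {n = d} id)))))))
      where
      others : List (Fin d)
      others = filter (λ b → ¬? (b Fin.≟ a)) (allFin d)

  module _ (G : SimpleGraph) {d : ℕ} (regular : Regular G d) where

    open SimpleGraph G
    open WalkParities G
    open BinaryVectors

    count : ℕ → Fin order → Fin order → 𝔽₂^ size → ℕ
    count ℓ u v z = length (filter (_≟ᵛ z) (parities ℓ u v))

    -- Adding an edge vector is an involution, so the contribution of the first edge can be moved
    -- from the walk to the target vector.
    count-suc : ∀ ℓ u v z → count (suc ℓ) u v z ≡ ListAction.sum (map (λ j → count ℓ j v (edgeVector (u , j) ⊕ z)) (neighbours G u))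
    count-suc ℓ u v z = trans (cong length (filter-concatMap (_≟ᵛ z) first-step (neighbours G u)))
      (trans (length-concatMap (filter (_≟ᵛ z) ∘ first-step) (neighbours G u))
        (cong ListAction.sum (List.map-cong (λ j → shifted (edgeVector (u , j)) (parities ℓ j v)) (neighbours G u))))
      where
      first-step : Fin order → List (𝔽₂^ size)
      first-step j = map (edgeVector (u , j) ⊕_) (parities ℓ j v)
      shifted : ∀ e zs → length (filter (_≟ᵛ z) (map (e ⊕_) zs)) ≡ length (filter (_≟ᵛ (e ⊕ z)) zs)
      shifted e zs = trans (cong length (filter-map (_≟ᵛ z) (e ⊕_) zs)) (trans (List.length-map (e ⊕_) (filter (λ y → (e ⊕ y) ≟ᵛ z) zs))
        (cong length (List.filter-≐ (λ y → (e ⊕ y) ≟ᵛ z) (_≟ᵛ (e ⊕ z))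
          ((λ {y} eq → trans (sym (⊕-cancelˡ e y)) (cong (e ⊕_) eq)) ,
           (λ {y} eq → trans (cong (e ⊕_) eq) (⊕-cancelˡ e z))) zs)))

    edgeVector-sym : ∀ u v → edgeVector (u , v) ≡ edgeVector (v , u)
    edgeVector-sym u v = Vec.tabulate-cong (λ e →
      cong (if_then 1ℙ else 0ℙ) (does-⇔ (mk⇔ swap swap) (joins? G e (u , v)) (joins? G e (v , u))))

    neighbours-sym : ∀ {u v} → u ∈ neighbours G v → v ∈ neighbours G u
    neighbours-sym {u} {v} u∈ with ∈-filter⁻ (adjacent? G v) {xs = allFin order} u∈
    ... | _ , e , e-joins = ∈-filter⁺ (adjacent? G u) (∈-allFin v) (e , swap e-joins)

    -- Backtracking is allowed: only the length and the parity vector matter.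
    data Path (v : Fin order) : ℕ → Fin order → 𝔽₂^ size → Set where
      []   : Path v 0 v 𝟘
      step : ∀ {h y z} x → x ∈ neighbours G y → Path v h y z → Path v (suc h) x (edgeVector (y , x) ⊕ z)

    -- Every step of a returning tree walk is matched: a step towards the root
    -- undoes the last edge of the path, every other step extends it.
    returns≤count : ∀ ℓ {v h x z} → Path v h x z → returns d ℓ h ℕ.≤ count ℓ x v z
    returns≤count zero {v} [] rewrite dec-true (v Fin.≟ v) refl | dec-true (𝟘 {size} ≟ᵛ 𝟘) refl = s≤s z≤n
    returns≤count zero (step _ _ _) = z≤n
    returns≤count (suc ℓ) {v} [] = subst₂ ℕ._≤_ (cong (ℕ._* returns d ℓ 1) (regular v)) (sym (count-suc ℓ v v 𝟘))
      (sum-map-≥ _ (neighbours G v) (λ {j} j∈ → returns≤count ℓ (step j j∈ [])))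
    returns≤count (suc ℓ) {v} p@(step {h} {y} {z} x x∈ q) = subst₂ ℕ._≤_
      (cong (λ m → returns d ℓ h ℕ.+ (m ℕ.∸ 1) ℕ.* returns d ℓ (2 ℕ.+ h)) (regular x)) (sym (count-suc ℓ x v _))
      (sum-map-≥-special _ (neighbours-sym x∈)
        (subst (λ z′ → returns d ℓ h ℕ.≤ count ℓ y v z′) (sym undo) (returns≤count ℓ q))
        (λ {j} j∈ → returns≤count ℓ (step j j∈ p)))
      where
      undo : edgeVector (x , y) ⊕ (edgeVector (y , x) ⊕ z) ≡ z
      undo = trans (cong (_⊕ (edgeVector (y , x) ⊕ z)) (edgeVector-sym x y)) (⊕-cancelˡ (edgeVector (y , x)) z)

    treeClosedWalks≤closedWalkCount : ∀ ℓ → order ℕ.* treeClosedWalks ℓ d ℕ.≤ closedWalkCount G ℓ 𝟘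
    treeClosedWalks≤closedWalkCount ℓ = subst₂ ℕ._≤_
      (cong₂ ℕ._*_ (List.length-tabulate {n = order} id) (sym (returnsFrom≡returns d ℓ [])))
      (sym (trans (closedWalkCount≡ ℓ 𝟘) (trans (cong length (filter-concatMap (_≟ᵛ 𝟘) (λ v → parities ℓ v v) (allFin order)))
        (length-concatMap (λ v → filter (_≟ᵛ 𝟘) (parities ℓ v v)) (allFin order)))))
      (sum-map-≥ (λ v → count ℓ v v 𝟘) (allFin order) (λ {v} _ → returns≤count ℓ []))

-- Averages of traces, and the minimal spectral radius of the family.

module TraceAverages (ℝ : RealNumbers) (G : SimpleGraph) where

  open RealNumbers ℝ hiding (zero)
  open SimpleGraph G
  open SignedGraphs ℝ G
  open OrderedField ℝ
  open SpectralRadius ℝ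
  open ListSums ℝ
  open CharacterSums ℝ G
  open BinaryVectors
  open WalkParities G
  open SignedWalks ℝ G
  open SetoidReasoning setoid

  ∈-allVectors : ∀ {m} (s : 𝔽₂^ m) → s ∈ allVectors m
  ∈-allVectors []       = here ≡.refl
  ∈-allVectors (0ℙ ∷ s) = ∈-cartesianProductWith⁺ _∷_ {xs = 0ℙ ∷ 1ℙ ∷ []} (here ≡.refl) (∈-allVectors s)
  ∈-allVectors (1ℙ ∷ s) = ∈-cartesianProductWith⁺ _∷_ {xs = 0ℙ ∷ 1ℙ ∷ []} (there (here ≡.refl)) (∈-allVectors s)

  length-pos : ∀ {A : Set} {x : A} {xs} → x ∈ xs → 1 ℕ.≤ length xs
  length-pos (here _)  = s≤s z≤n
  length-pos (there _) = s≤s z≤n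

  -- The number of solutions stays as a factor; consistency enters where this factor is cancelled as
  -- a positive number.
  sum-of-traces : ∀ gs (π : 𝔽₂^ size → Parity) → (∀ s → Solution gs s → ∀ {z} → z ∈ span gs → π z ≡ dot s z) → ∀ ℓ →
    ∑[ s ∈ solutions gs ] trace (power (signedAdjacency s) ℓ) ≈ fromℕ (length (solutions gs)) * signedCount π ℓ (span gs)
  sum-of-traces gs π π≡dot ℓ = begin
    ∑[ s ∈ solutions gs ] trace (power (signedAdjacency s) ℓ)
      ≈⟨ sumOver-cong (solutions gs) (λ s → trace-power s ℓ) ⟩
    ∑[ s ∈ solutions gs ] (∑[ z ∈ closedParities ℓ ] sign (dot s z))
      ≈⟨ character-sum-list gs π π≡dot (closedParities ℓ) ⟩
    fromℕ (length (solutions gs)) * ∑[ w ∈ span gs ] (sign (π w) * fromℕ (length (filter (_≟ᵛ w) (closedParities ℓ))))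
      ≈⟨ *-congˡ (sumOver-cong (span gs) (λ w → *-congˡ (reflexive (≡.cong fromℕ (≡.sym (closedWalkCount≡ ℓ w)))))) ⟩
    fromℕ (length (solutions gs)) * signedCount π ℓ (span gs) ∎

  expectedTrace≈ : ∀ ℓ → expectedTrace ℓ ≈ fromℕ (closedWalkCount G ℓ 𝟘)
  expectedTrace≈ ℓ = begin
    sumOver (signings G) f * K ⁻¹                        ≡⟨ ≡.cong (λ ss → sumOver ss f * K ⁻¹) (≡.sym all-solve) ⟩
    sumOver (solutions {size} []) f * K ⁻¹
      ≈⟨ *-congʳ (sum-of-traces [] (λ _ → 0ℙ) (λ { s _ (here ≡.refl) → ≡.sym (dot-𝟘ʳ s) }) ℓ) ⟩
    fromℕ (length (solutions {size} [])) * (1# * N + 0#) * K ⁻¹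
      ≡⟨ ≡.cong (λ ss → fromℕ (length ss) * (1# * N + 0#) * K ⁻¹) all-solve ⟩
    K * (1# * N + 0#) * K ⁻¹
      ≈⟨ *-congʳ (*-congˡ (trans (+-identityʳ _) (*-identityˡ N))) ⟩
    K * N * K ⁻¹
      ≈⟨ solve 3 (λ k n i → k :* n :* i := n :* (k :* i)) refl K N (K ⁻¹) ⟩
    N * (K * K ⁻¹)
      ≈⟨ *-congˡ (⁻¹-inverse K (pos⇒≉0 (fromℕ-pos (length-pos (∈-allVectors {size} 𝟘))))) ⟩
    N * 1#                                               ≈⟨ *-identityʳ N ⟩
    N                                                    ∎
    where
    f : 𝔽₂^ size → Carrier
    f s = trace (power (signedAdjacency s) ℓ)
    K N : Carrier
    K = fromℕ (length (signings G))
    N = fromℕ (closedWalkCount G ℓ 𝟘)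
    all-solve : solutions {size} [] ≡ signings G
    all-solve = List.filter-all (solution? []) (All.universal (λ _ → []) (signings G))

  sumOver-isolate-𝟘 : ∀ {m} {zs : List (𝔽₂^ m)} (f : 𝔽₂^ m → Carrier) → Unique zs → 𝟘 ∈ zs →
                      sumOver zs f ≈ sumOver (filter (λ z → ¬? (z ≟ᵛ 𝟘)) zs) f + f 𝟘
  sumOver-isolate-𝟘 {zs = zs} f zs! 𝟘∈zs = begin
    sumOver zs f
      ≈⟨ sumOver-cong zs split ⟩
    ∑[ z ∈ zs ] ((if does (¬? (z ≟ᵛ 𝟘)) then f z else 0#) + f z * indicator (𝟘 ≟ᵛ z))
      ≈⟨ sumOver-+ zs _ _ ⟩
    ∑[ z ∈ zs ] (if does (¬? (z ≟ᵛ 𝟘)) then f z else 0#) + ∑[ z ∈ zs ] (f z * indicator (𝟘 ≟ᵛ z))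
      ≈⟨ +-cong (sym (sumOver-filter (λ z → ¬? (z ≟ᵛ 𝟘)) zs f)) (sumOver-indicator-∈ f zs! 𝟘∈zs) ⟩
    sumOver (filter (λ z → ¬? (z ≟ᵛ 𝟘)) zs) f + f 𝟘 ∎
    where
    split : ∀ z → f z ≈ (if does (¬? (z ≟ᵛ 𝟘)) then f z else 0#) + f z * indicator (𝟘 ≟ᵛ z)
    split z with z ≟ᵛ 𝟘 | 𝟘 ≟ᵛ z
    ... | yes _   | yes _   = sym (trans (+-identityˡ _) (*-identityʳ (f z)))
    ... | no _    | no _    = sym (trans (+-congˡ (zeroʳ (f z))) (+-identityʳ (f z)))
    ... | yes z≡𝟘 | no 𝟘≢z  = contradiction (≡.sym z≡𝟘) 𝟘≢z
    ... | no z≢𝟘  | yes 𝟘≡z = contradiction (≡.sym 𝟘≡z) z≢𝟘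

  minimiser : ∀ {A : Set} (f : A → Carrier) {x xs} → x ∈ xs → ∃[ y ] y ∈ xs × (∀ {z} → z ∈ xs → f y ≤ f z)
  minimiser {A} f {xs = x ∷ []} _ = x , here ≡.refl , λ { (here ≡.refl) → ≤-refl }
  minimiser {A} f {xs = x ∷ x′ ∷ xs} _ = extend (minimiser f {xs = x′ ∷ xs} (here ≡.refl))
    where
    extend : (∃[ y ] y ∈ x′ ∷ xs × (∀ {z} → z ∈ x′ ∷ xs → f y ≤ f z)) →
             ∃[ y ] y ∈ x ∷ x′ ∷ xs × (∀ {z} → z ∈ x ∷ x′ ∷ xs → f y ≤ f z)
    extend (y , y∈ , y-min) with f x <? f y
    ... | yes fx<fy = x , here ≡.refl , λ { (here ≡.refl) → ≤-refl ; (there z∈) → ≤-trans (inj₁ fx<fy) (y-min z∈) }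
    ... | no  fx≮fy = y , there y∈ , λ { (here ≡.refl) → ≮⇒≥ fx≮fy ; (there z∈) → y-min z∈ }

  eigenvalue-class : ∀ {s t} → SwitchingEquivalent G s t → ∀ {μ} →
                     IsEigenvalue (signedAdjacency s) μ → IsEigenvalue (signedAdjacency t) μ
  eigenvalue-class Star.ε       μ-eigen = μ-eigen
  eigenvalue-class (sw ◅ sws) μ-eigen = eigenvalue-class sws (eigenvalue-switch sw μ-eigen)

  module Family (v₀ : Fin order) (L : ℕ) s₀ (s₀-solves : Solves G L s₀)
                (π : 𝔽₂^ size → Parity) (form : IsConstraintForm G L π) where

    open IsConstraintForm form

    gs : List (𝔽₂^ size)
    gs = constraints G L

    s₀∈ : s₀ ∈ solutions gs
    s₀∈ = ∈-filter⁺ (solution? gs) (∈-allVectors s₀) s₀-solves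

    π≡dot : ∀ s → Solution gs s → ∀ {z} → z ∈ W G L → π z ≡ dot s z
    π≡dot s s-solves z∈ = constraintForm≡dot (W G L) π additive s gs (∈-deduplicate⁺ _≟ᵛ_) constraint s-solves
      (∈-deduplicate⁻ _≟ᵛ_ (subsetSums gs) z∈)

    count : Carrier
    count = fromℕ (length (solutions gs))

    0<count : 0# < count
    0<count = fromℕ-pos (length-pos s₀∈)

    radius : ∀ s → ∃ (IsSpectralRadius (signedAdjacency s))
    radius s = spectralRadius v₀ (signedAdjacency s) (signedAdjacency-sym s)

    ρ : 𝔽₂^ size → Carrier
    ρ s = proj₁ (radius s)

    ρ-nonneg : ∀ s → 0# ≤ ρ s
    ρ-nonneg s with radius s
    ... | _ , (μ , _ , ρ≈∣μ∣) , _ = ≤-resp refl (sym ρ≈∣μ∣) (∣∣-nonneg μ)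

    best : ∃[ s ] s ∈ solutions gs × (∀ {t} → t ∈ solutions gs → ρ s ≤ ρ t)
    best = minimiser ρ s₀∈

    ρmin : Carrier
    ρmin = ρ (proj₁ best)

    -- A signing s of the family is equivalent to some solution t. The eigenvalue realising `ρ t` is
    -- also one of s, so any spectral radius of s is at least `ρ t`, hence at least the minimum over
    -- the finite list of solutions.
    ρmin-isMinimum : IsMinSpectralRadius L ρmin
    ρmin-isMinimum =
      (proj₁ best , (proj₁ best , proj₂ (∈-filter⁻ (solution? gs) {xs = allVectors size} (proj₁ (proj₂ best))) , Star.ε) , proj₂ (radius (proj₁ best))) ,
      λ { x (s , (t , t-solves , t∼s) , _ , x-max) →
            ≤-trans (proj₂ (proj₂ best) (∈-filter⁺ (solution? gs) (∈-allVectors t) t-solves)) (ρ-bound t∼s x-max) }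
      where
      ρ-bound : ∀ {s t x} → SwitchingEquivalent G t s →
                (∀ y → ∃[ μ ] IsEigenvalue (signedAdjacency s) μ × y ≈ ∣ μ ∣ → y ≤ x) → ρ t ≤ x
      ρ-bound {t = t} t∼s x-max with radius t
      ... | _ , (μ , μ-eigen , ρ≈∣μ∣) , _ = x-max _ (μ , eigenvalue-class t∼s μ-eigen , ρ≈∣μ∣)

    module _ (k : ℕ) where

      -- The individual terms carry signs, but the total is a mean of even-power traces. This is
      -- what makes the 2k-th root R exist.
      signedCount-nonneg : 0# ≤ signedCount π (2 ℕ.* k) (W G L)
      signedCount-nonneg = *-cancelˡ-≤ 0<count (≤-resp
        (trans (sumOver-zero (solutions gs)) (sym (zeroʳ count)))
        (sum-of-traces gs π π≡dot (2 ℕ.* k))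
        (sumOver-mono-∈ (solutions gs) (λ {s} _ → trace-even-power-nonneg (signedAdjacency-sym s) k)))

      ρmin-power≤ : ρmin ^ (2 ℕ.* k) ≤ signedCount π (2 ℕ.* k) (W G L)
      ρmin-power≤ = *-cancelˡ-≤ 0<count (≤-resp
        (sumOver-const (solutions gs) (ρmin ^ (2 ℕ.* k)))
        (sum-of-traces gs π π≡dot (2 ℕ.* k))
        (sumOver-mono-∈ (solutions gs) (λ {s} s∈ → ≤-trans
          (^-mono-≤ (2 ℕ.* k) (ρ-nonneg (proj₁ best)) (proj₂ (proj₂ best) s∈))
          (spectralRadius-power≤trace (signedAdjacency-sym s) (proj₂ (radius s)) k))))

      signedCount-isolate-𝟘 : signedCount π (2 ℕ.* k) (W G L) ≈
        signedCount π (2 ℕ.* k) (filter (λ z → ¬? (z ≟ᵛ 𝟘)) (W G L)) + fromℕ (closedWalkCount G (2 ℕ.* k) 𝟘)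
      signedCount-isolate-𝟘 = trans
        (sumOver-isolate-𝟘 (λ z → sign (π z) * fromℕ (closedWalkCount G (2 ℕ.* k) z))
          (deduplicate-! _≟ᵛ_ (subsetSums gs)) (𝟘∈span gs))
        -- The zero vector enters with sign +1, because π agrees there with the dot product with the
        -- solution `s₀`.
        (+-congˡ (trans (*-congʳ (reflexive (≡.cong sign (≡.trans (π≡dot s₀ s₀-solves (𝟘∈span gs)) (dot-𝟘ʳ s₀))))) (*-identityˡ _)))

-- Transfer of inequalities between numbers and their roots.

module RootComparison (ℝ : RealNumbers) where

  open RealNumbers ℝ hiding (zero)
  open OrderedField ℝ

  isRoot-mono-≤ : ∀ {n x y r q} → 1 ℕ.≤ n → IsRoot n x r → IsRoot n y q → x ≤ y → r ≤ q
  isRoot-mono-≤ 1≤n (_ , rⁿ≈x) (0≤q , qⁿ≈y) x≤y = ^-cancel-≤ 1≤n 0≤q (≤-resp (sym rⁿ≈x) (sym qⁿ≈y) x≤y)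

  isRoot-<⇔ : ∀ {n x y r q} → 1 ℕ.≤ n → IsRoot n x r → IsRoot n y q → r < q ⇔ x < y
  isRoot-<⇔ {n} 1≤n (0≤r , rⁿ≈x) (0≤q , qⁿ≈y) = mk⇔
    (λ r<q → <-resp rⁿ≈x qⁿ≈y (^-mono-< 1≤n 0≤r r<q))
    (λ x<y → ^-cancel-< n 0≤q (<-resp (sym rⁿ≈x) (sym qⁿ≈y) x<y))

  move-<⇔ : ∀ {s s′ a b} → s ≈ s′ + a → s < b ⇔ s′ < - (a - b)
  move-<⇔ {s} {s′} {a} {b} s≈s′+a = mk⇔
    (λ s<b → <-by (solve 3 (λ s′ a b → :- (a :- b) := s′ :+ (b :- (s′ :+ a))) refl s′ a b)
      (sub-pos (<-resp s≈s′+a refl s<b)))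
    (λ s′<b-a → <-resp (sym s≈s′+a) refl
      (<-by (solve 3 (λ s′ a b → b := (s′ :+ a) :+ (:- (a :- b) :- s′)) refl s′ a b) (sub-pos s′<b-a)))

corollary8 :
  (ℝ : RealNumbers) (G : SimpleGraph) → Connected G →
  (L : ℕ) → 1 ℕ.≤ L → Consistent G L →
  (π : 𝔽₂^ (SimpleGraph.size G) → Parity) → IsConstraintForm G L π →
  (k : ℕ) → 1 ℕ.≤ k →
  let open RealNumbers ℝ
      open SignedGraphs ℝ G
      n = SimpleGraph.order G
      N = closedWalkCount G (2 ℕ.* k)
  in
  ∃[ R ] IsRoot (2 ℕ.* k) (signedCount π (2 ℕ.* k) (W G L)) R
  × (∃[ ρmin ] IsMinSpectralRadius L ρmin × ρmin ≤ R)
  × ((d : ℕ) → Regular G d →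
      let nt = n ℕ.* treeClosedWalks (2 ℕ.* k) d in
      expectedTrace (2 ℕ.* k) ≈ fromℕ (N 𝟘)
      × nt ℕ.≤ N 𝟘
      × (∃[ E ] ∃[ T ] IsRoot (2 ℕ.* k) (expectedTrace (2 ℕ.* k)) E
         × IsRoot (2 ℕ.* k) (fromℕ nt) T
         × ¬ (E < T)
         × (R < T ⇔ signedCount π (2 ℕ.* k) (filter (λ z → ¬? (z ≟ᵛ 𝟘)) (W G L)) < - (fromℕ (N 𝟘) - fromℕ nt))))
corollary8 ℝ G (v₀ , _) L _ (s₀ , s₀-solves) π form k 1≤k =
  proj₁ R-root , proj₂ R-root ,
  (ρmin , ρmin-isMinimum , ^-cancel-≤ 1≤2k (proj₁ (proj₂ R-root)) (≤-resp refl (sym (proj₂ (proj₂ R-root))) (ρmin-power≤ k))) ,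
  λ d regular →
    let nt≤N  = treeClosedWalks≤closedWalkCount G regular (2 ℕ.* k)
        trE≈N = expectedTrace≈ (2 ℕ.* k)
        E-root = root 1≤2k (≤-resp refl (sym trE≈N) (fromℕ-nonneg (closedWalkCount G (2 ℕ.* k) 𝟘)))
        T-root = root 1≤2k (fromℕ-nonneg (SimpleGraph.order G ℕ.* treeClosedWalks (2 ℕ.* k) d))
    in trE≈N , nt≤N , proj₁ E-root , proj₁ T-root , proj₂ E-root , proj₂ T-root ,
       ≤⇒≯ (isRoot-mono-≤ 1≤2k (proj₂ T-root) (proj₂ E-root) (≤-resp refl (sym trE≈N) (fromℕ-mono nt≤N))) ,
       -- Comparing 2k-th powers turns R < T into an inequality between the signed count and n
       -- t_{2k}(d); splitting off the term N_{2k}(0) of the zero vector then gives the stated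
       -- criterion.
       move-<⇔ (signedCount-isolate-𝟘 k) ⇔-∘ isRoot-<⇔ 1≤2k (proj₂ R-root) (proj₂ T-root)
  where
  open RealNumbers ℝ hiding (zero)
  open SignedGraphs ℝ G
  open OrderedField ℝ
  open TraceAverages ℝ G
  open Family v₀ L s₀ s₀-solves π form
  open RootComparison ℝ
  open TreeWalks
  1≤2k : 1 ℕ.≤ 2 ℕ.* k
  1≤2k = ℕ.≤-trans 1≤k (ℕ.m≤m+n k _)
  R-root : ∃ (IsRoot (2 ℕ.* k) (signedCount π (2 ℕ.* k) (W G L)))
  R-root = root 1≤2k (signedCount-nonneg k)
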